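{- Fix a nonnegative integer $n$. Let $$\pi_0 <_{lex} \pi_1 <_{lex} \dots <_{lex} \pi_{k-1} <_{lex} \pi_k$$ be the sequence of all fixed points of PSSPM($n$), listed in increasing lexicographic order. Then $$\pi_0 \triangleleft \pi_1 \triangleleft \dots \triangleleft \pi_{k-1} \triangleleft \pi_k .$$ Moreover, for every fixed point $\pi$ of SSPM($n$) such that $\pi_0 \leq_{lex} \pi \leq_{lex} \pi_k$, there exists an index $i$ with $0 \leq i \leq k$ and $\pi_i=\pi$.
   Context: A configuration is a sequence $c=(c_i)_{i\in\mathbb Z}$ of nonnegative integers with only finitely many nonzero terms. The initial configuration $(\underline{n})$ is given by $c_0=n$ and $c_i=0$ for $i\neq 0$. There are two local rules. - Rule $\mathcal L$ at column $i$ is applicable when $a_{i-1}+2\le a_i$. It moves one grain from column $i$ to column $i-1$: $a_i$ decreases by 1 and $a_{i-1}$ increases by 1. - Rule $\mathcal R$ at column $i$ is applicable when $a_i\ge a_{i+1}+2$. It moves one grain from column $i$ to column $i+1$. The two global dynamics are as follows. - SSPM (Symmetric Sand Pile Model): one step applies exactly one applicable local rule at one column. - PSSPM (Parallel SSPM): one step applies, simultaneously, at every column where at least one local rule is applicable, exactly one applicable local rule. Where both are applicable, either one may be chosen. SSPM($n$) (resp. PSSPM($n$)) is the set of configurations reachable from $(\underline{n})$ by finitely many steps of the respective dynamics. A fixed point of SSPM($n$) (resp. PSSPM($n$)) is a configuration in that set at which no local rule is applicable. The lexicographic order is defined as follows: $a<_{lex}b$ iff $a\neq b$ and $a_i<b_i$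 at the smallest index $i$ with $a_i\neq b_i$. Let $\Delta(a,b)$ denote the sequence $\Delta_i(a,b)=a_i-b_i$. The relation $a\triangleleft b$ holds iff there are indices $i<j$ such that $\Delta_i(a,b)=-1$, $\Delta_j(a,b)=1$, and $\Delta_m(a,b)=0$ for all $m\notin\{i,j\}$. -}

module Defs where

open import Data.Nat using (ℕ; zero; suc; _+_; _≤_; _<_)
open import Data.Integer as ℤ using (ℤ; +_; -[1+_]; 1ℤ)
open import Data.Fin using (Fin; inject₁) renaming (suc to fsuc)
open import Data.Product using (Σ; ∃; _×_; _,_)
open import Data.Sum using (_⊎_)
open import Relation.Nullary using (¬_)
open import Relation.Binary.PropositionalEquality using (_≡_; _≢_)
open import Relation.Binary.Construct.Closure.ReflexiveTransitive using (Star)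

-- A configuration: a column-indexed sequence of grain counts.
-- (All configurations reachable from the initial one have finite support.)
Config : Set
Config = ℤ → ℕ

_≈c_ : Config → Config → Set
a ≈c b = ∀ i → a i ≡ b i

init : ℕ → Config
init n (+ zero)   = n
init n (+ suc _)  = 0
init n -[1+ _ ]   = 0

LApp : Config → ℤ → Set
LApp a i = a (i ℤ.- 1ℤ) + 2 ≤ a i

RApp : Config → ℤ → Set
RApp a i = a (i ℤ.+ 1ℤ) + 2 ≤ a i

SStep : Config → Config → Set
SStep a b = ∃ λ i →
    (LApp a i × suc (b i) ≡ a i × b (i ℤ.- 1ℤ) ≡ suc (a (i ℤ.- 1ℤ))
       × (∀ j → j ≢ i → j ≢ i ℤ.- 1ℤ → b j ≡ a j))
  ⊎ (RApp a i × suc (b i) ≡ a i × b (i ℤ.+ 1ℤ) ≡ suc (a (i ℤ.+ 1ℤ))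
       × (∀ j → j ≢ i → j ≢ i ℤ.+ 1ℤ → b j ≡ a j))

data Choice : Set where
  none left right : Choice

Valid : Config → ℤ → Choice → Set
Valid a i none  = ¬ LApp a i × ¬ RApp a i
Valid a i left  = LApp a i
Valid a i right = RApp a i

out : Choice → ℕ
out none  = 0
out left  = 1
out right = 1

inFromRight : Choice → ℕ   -- grain arriving from column j+1 (it fired L)
inFromRight left = 1
inFromRight _    = 0

inFromLeft : Choice → ℕ    -- grain arriving from column j-1 (it fired R)
inFromLeft right = 1
inFromLeft _     = 0

PStep : Config → Config → Set
PStep a b = ∃ λ (d : ℤ → Choice) → (∀ i → Valid a i (d i)) ×
  (∀ j → b j + out (d j) ≡ a j + inFromRight (d (j ℤ.+ 1ℤ)) + inFromLeft (d (j ℤ.- 1ℤ)))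

SSPM : ℕ → Config → Set
SSPM n a = Star SStep (init n) a

PSSPM : ℕ → Config → Set
PSSPM n a = Star PStep (init n) a

Stable : Config → Set
Stable a = ∀ i → ¬ LApp a i × ¬ RApp a i

FixSSPM : ℕ → Config → Set
FixSSPM n a = SSPM n a × Stable a

FixPSSPM : ℕ → Config → Set
FixPSSPM n a = PSSPM n a × Stable a

_<lex_ : Config → Config → Set
a <lex b = ∃ λ i → a i < b i × (∀ j → j ℤ.< i → a j ≡ b j)

_≤lex_ : Config → Config → Set
a ≤lex b = a <lex b ⊎ a ≈c b

_◁_ : Config → Config → Set
a ◁ b = ∃ λ i → ∃ λ j → i ℤ.< j × b i ≡ suc (a i) × a j ≡ suc (b j)
  × (∀ m → m ≢ i → m ≢ j → a m ≡ b m)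

{-# OPTIONS --safe #-}
-- Replace a configuration a by its potential A k = number of grains in the columns ≤ k. A step then acts on
-- sites: with D k = A (k+1) + A (k−1) − 2 A k, rule L at column k+1 raises A k (allowed when D k ≥ 2) and rule R
-- at column k lowers A k (allowed when D k ≤ −2), a discrete heat flow. It is monotone and commutes with adding a
-- constant, so two configurations whose potentials differ by at most 1 everywhere can be moved in parallel
-- so that this persists; the choice at columns where both rules apply is resolved by looking at the companion.
-- Since the two successors of one configuration are close, any two fixed points of PSSPM(n) are joined by a
-- chain of fixed points of PSSPM(n) with consecutive potentials close.
--
-- Reachable configurations consist of two slopes on which at most one unit of height is lost with respect to a
-- staircase. Hence the difference of two stable ones changes sign only once: the lexicographic order coincides
-- with the pointwise order of potentials, and close stable configurations a <lex b satisfy a ◁ b.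
--
-- If a stable p lay strictly between two consecutive members u < p < v of the chain, then the sites where u is
-- below p would come before those where v is above p: both sets are intervals which start in that order, move
-- by overlapping steps, and are kept disjoint by closeness. For stable u, p, v the slopes exclude this.
module Submission where

open import Defs
open import Data.Empty using (⊥; ⊥-elim)
open import Data.Fin using (Fin; inject₁; zero; fromℕ; toℕ) renaming (suc to fsuc)
open import Data.Fin.Properties using (toℕ-inject₁)
open import Data.Integer as ℤ using (ℤ; +_; -[1+_]; 0ℤ; 1ℤ; -1ℤ; _+_; _-_; -_; _*_; _≤_; _<_; ∣_∣; +≤+; +<+)
open import Data.Integer.Properties
open import Data.Integer.Tactic.RingSolver using (solve)
open import Data.List using ([]; _∷_)
open import Data.Nat as ℕ using (ℕ; zero; suc)
import Data.Nat.Properties as ℕₚ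
open import Data.Product using (∃; _×_; _,_; proj₁; proj₂)
open import Data.Sum using (_⊎_; inj₁; inj₂)
open import Relation.Binary using (tri<; tri≈; tri>)
open import Relation.Binary.Construct.Closure.ReflexiveTransitive as Star using (Star; ε; _◅_; _◅◅_)
open import Relation.Binary.PropositionalEquality using (_≡_; _≢_; refl; sym; trans; cong; cong₂; subst; subst₂)
open import Relation.Nullary using (¬_; Dec; yes; no)

-- Integer inequalities and potentials

infixl 5 _⊕_
_⊕_ : ∀ {a b c d} → a ≤ b → c ≤ d → a + c ≤ b + d
_⊕_ = +-mono-≤

-- Abstract, so that the ring solver's proofs are never evaluated.
abstract
  linear : ∀ {p q x y} → x ≤ y → q - p ≡ y - x → p ≤ q
  linear h e = 0≤i-j⇒j≤i (subst (0ℤ ≤_) (sym e) (i≤j⇒0≤j-i h))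

  refute : ∀ {x y} c → x ≤ y → x - y ≡ + suc c → ⊥
  refute {x} {y} c h e with linear {+ suc c} {0ℤ} h (trans (cong (λ z → 0ℤ - z) (sym e)) (solve (x ∷ y ∷ [])))
  ... | +≤+ ()

<⇒+1≤ : ∀ {x y} → x < y → x + 1ℤ ≤ y
<⇒+1≤ {x} h = subst (_≤ _) (+-comm 1ℤ x) (i<j⇒suc[i]≤j h)

+1≤⇒< : ∀ {x y} → x + 1ℤ ≤ y → x < y
+1≤⇒< {x} h = suc[i]≤j⇒i<j (subst (_≤ _) (+-comm x 1ℤ) h)

pos-+1≤ : ∀ {m n} → m ℕ.< n → + m + 1ℤ ≤ + n
pos-+1≤ {m} h = <⇒+1≤ (+<+ h)

pos-+2≤ : ∀ {m n} → m ℕ.+ 2 ℕ.≤ n → + m + + 2 ≤ + n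
pos-+2≤ h = +≤+ h

k-1+1 : ∀ k → k - 1ℤ + 1ℤ ≡ k
k-1+1 k = solve (k ∷ [])

k+1-1 : ∀ k → k + 1ℤ - 1ℤ ≡ k
k+1-1 k = solve (k ∷ [])

k<k+1 : ∀ k → k < k + 1ℤ
k<k+1 k = +1≤⇒< ≤-refl

k-1<k : ∀ k → k - 1ℤ < k
k-1<k k = +1≤⇒< (≤-reflexive (k-1+1 k))

<⇒≤-1 : ∀ {x y} → x < y → x ≤ y - 1ℤ
<⇒≤-1 {x} {y} h = linear (<⇒+1≤ h) (solve (x ∷ y ∷ []))

≤⇒offset : ∀ {x y} → x ≤ y → ∃ λ m → y ≡ x + + m
≤⇒offset {x} {y} h = ∣ y - x ∣ , trans (lem x y) (cong (λ z → x + z) (sym (0≤i⇒+∣i∣≡i (i≤j⇒0≤j-i h))))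
  where
  lem : ∀ x y → y ≡ x + (y - x)
  lem x y = solve (x ∷ y ∷ [])

k+suc-1 : ∀ k m → k + + suc m - 1ℤ ≡ k + + m
k+suc-1 k m = trans (cong (λ z → k + z - 1ℤ) (+-comm 1ℤ (+ m))) (lem k (+ m))
  where
  lem : ∀ k m → k + (m + 1ℤ) - 1ℤ ≡ k + m
  lem k m = solve (k ∷ m ∷ [])

record State : Set where
  field
    cfg      : Config
    pot      : ℤ → ℤ
    pot-step : ∀ k → pot k ≡ pot (k - 1ℤ) + + cfg k
open State public

pot-next : ∀ X k → pot X (k + 1ℤ) ≡ pot X k + + cfg X (k + 1ℤ)
pot-next X k = trans (pot-step X (k + 1ℤ)) (cong (λ j → pot X j + + cfg X (k + 1ℤ)) (k+1-1 k))

pot-mono : ∀ X {k l} → k ≤ l → pot X k ≤ pot X l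
pot-mono X {k} k≤l with ≤⇒offset k≤l
... | m , refl = go m
  where
  go : ∀ m → pot X k ≤ pot X (k + + m)
  go zero = ≤-reflexive (cong (pot X) (sym (+-identityʳ k)))
  go (suc m) = ≤-trans (go m) (subst₂ _≤_ (cong (pot X) (k+suc-1 k m)) (sym (pot-step X _)) (i≤i+j _ (+ cfg X (k + + suc m))))

-- pot Y − pot X can only grow across a column where Y is higher than X.
rise : ∀ X Y {k l} → k ≤ l → pot Y k + pot X l + 1ℤ ≤ pot Y l + pot X k →
       ∃ λ x → k < x × x ≤ l × cfg X x ℕ.< cfg Y x
rise X Y {k} k≤l h with ≤⇒offset k≤l
... | m , refl = go m h
  where
  base : ∀ a b → a + b + 1ℤ ≤ a + b → ⊥
  base a b h = refute 0 h (solve (a ∷ b ∷ []))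
  back : ∀ yk xl yl xk xl′ yl′ cx cy → xl ≡ xl′ + cx → yl ≡ yl′ + cy → cy ≤ cx →
         yk + xl + 1ℤ ≤ yl + xk → yk + xl′ + 1ℤ ≤ yl′ + xk
  back yk _ _ xk xl′ yl′ cx cy refl refl h₁ h₂ =
    linear (h₁ ⊕ h₂) (solve (yk ∷ xk ∷ xl′ ∷ yl′ ∷ cx ∷ cy ∷ []))
  go : ∀ m → pot Y k + pot X (k + + m) + 1ℤ ≤ pot Y (k + + m) + pot X k →
       ∃ λ x → k < x × x ≤ k + + m × cfg X x ℕ.< cfg Y x
  go zero h = ⊥-elim (base (pot Y k) (pot X k)
    (subst (λ j → pot Y k + pot X j + 1ℤ ≤ pot Y j + pot X k) (+-identityʳ k) h))
  go (suc m) h with cfg X (k + + suc m) ℕ.<? cfg Y (k + + suc m)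
  ... | yes c = k + + suc m , +1≤⇒< (+-monoʳ-≤ k (+≤+ (ℕ.s≤s ℕ.z≤n))) , ≤-refl , c
  ... | no c with go m (subst (λ j → pot Y k + pot X j + 1ℤ ≤ pot Y j + pot X k) (k+suc-1 k m)
                 (back (pot Y k) _ _ (pot X k) (pot X (k + + suc m - 1ℤ)) (pot Y (k + + suc m - 1ℤ)) _ _
                   (pot-step X (k + + suc m)) (pot-step Y (k + + suc m)) (+≤+ (ℕₚ.≮⇒≥ c)) h))
  ...   | x , k<x , x≤ , d = x , k<x , ≤-trans x≤ (+-monoʳ-≤ k (+≤+ (ℕₚ.n≤1+n m))) , d

-- Slopes and stable configurations

-- The profile gains one grain per column on its way up to the split `S`; the summand `1ℤ` is the
-- one grain that may be lost, as at a plateau. Column `S` counts as left, whence `S < x` in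
-- `RightSlope`.
LeftSlope : Config → ℤ → Set
LeftSlope a S = ∀ x y → x < y → y ≤ S → 0 ℕ.< a x → + a x + (y - x) ≤ + a y + 1ℤ

RightSlope : Config → ℤ → Set
RightSlope a S = ∀ x y → S < x → x < y → 0 ℕ.< a y → + a y + (y - x) ≤ + a x + 1ℤ

Slopes : Config → Set
Slopes a = ∃ λ S → LeftSlope a S × RightSlope a S

≰+2⇒≤+1 : ∀ {m n} → ¬ (m ℕ.+ 2 ℕ.≤ n) → + n ≤ + m + 1ℤ
≰+2⇒≤+1 {m} {n} h = linear (<⇒+1≤ (+<+ (ℕₚ.≰⇒> h))) (lem (+ m) (+ n))
  where
  lem : ∀ m n → m + 1ℤ - n ≡ m + + 2 - (n + 1ℤ)
  lem m n = solve (m ∷ n ∷ [])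

module _ {a : Config} (st : Stable a) where
  next≤ : ∀ k → + a (k + 1ℤ) ≤ + a k + 1ℤ
  next≤ k = subst (λ j → + a (k + 1ℤ) ≤ + a j + 1ℤ) (k+1-1 k) (≰+2⇒≤+1 (proj₁ (st (k + 1ℤ))))

  prev≤ : ∀ k → + a k ≤ + a (k + 1ℤ) + 1ℤ
  prev≤ k = ≰+2⇒≤+1 (proj₂ (st k))

  private
    k+m+1 : ∀ k m → k + + m + 1ℤ ≡ k + + suc m
    k+m+1 k m = trans (+-assoc k (+ m) 1ℤ) (cong (λ z → k + z) (+-comm (+ m) 1ℤ))

    chain : ∀ x y z m → x ≤ y + m → y ≤ z + 1ℤ → x ≤ z + (m + 1ℤ)
    chain x y z m h₁ h₂ = linear (h₁ ⊕ h₂) (solve (x ∷ y ∷ z ∷ m ∷ []))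

    chain′ : ∀ x y z m → x ≤ y + 1ℤ → y ≤ z + m → x ≤ z + (m + 1ℤ)
    chain′ x y z m h₁ h₂ = linear (h₁ ⊕ h₂) (solve (x ∷ y ∷ z ∷ m ∷ []))

    climbs : ∀ k m → + a (k + + m) ≤ + a k + + m
    climbs k zero = ≤-reflexive (trans (cong (λ j → + a j) (+-identityʳ k)) (sym (+-identityʳ _)))
    climbs k (suc m) = subst₂ (λ j z → + a j ≤ + a k + z) (k+m+1 k m) (+-comm (+ m) 1ℤ)
      (chain′ (+ a (k + + m + 1ℤ)) (+ a (k + + m)) (+ a k) (+ m) (next≤ (k + + m)) (climbs k m))

    falls : ∀ k m → + a k ≤ + a (k + + m) + + m
    falls k zero = ≤-reflexive (trans (sym (+-identityʳ _)) (cong (λ j → + a j + 0ℤ) (sym (+-identityʳ k))))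
    falls k (suc m) = subst₂ (λ j z → + a k ≤ + a j + z) (k+m+1 k m) (+-comm (+ m) 1ℤ)
      (chain (+ a k) (+ a (k + + m)) (+ a (k + + m + 1ℤ)) (+ m) (falls k m) (prev≤ (k + + m)))

    m≡k+m-k : ∀ k m → m ≡ k + m - k
    m≡k+m-k k m = solve (k ∷ m ∷ [])

  climb : ∀ {x y} → x ≤ y → + a y ≤ + a x + (y - x)
  climb {x} h with ≤⇒offset h
  ... | m , refl = subst (λ z → + a (x + + m) ≤ + a x + z) (m≡k+m-k x (+ m)) (climbs x m)

  fall : ∀ {x y} → x ≤ y → + a x ≤ + a y + (y - x)
  fall {x} h with ≤⇒offset h
  ... | m , refl = subst (λ z → + a x ≤ + a (x + + m) + z) (m≡k+m-k x (+ m)) (falls x m)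

<⇒0< : ∀ {m n} → m ℕ.< n → 0 ℕ.< n
<⇒0< h = ℕₚ.≤-trans (ℕ.s≤s ℕ.z≤n) h

slope-clash : ∀ ax ay bx by d → ay ≤ ax + d → bx + d ≤ by + 1ℤ → ax + 1ℤ ≤ bx → by + 1ℤ ≤ ay → ⊥
slope-clash ax ay bx by d h₁ h₂ h₃ h₄ = refute 0 (h₁ ⊕ h₂ ⊕ h₃ ⊕ h₄) (solve (ax ∷ ay ∷ bx ∷ by ∷ d ∷ []))

-- From `x` to `y` the stable `a` gains at most `y - x` and `b` at least `y - x - 1`, whereas
-- passing from below `b` to above it requires a gain of two more than that of `b`.
left-clash : ∀ {a b S x y} → Stable a → LeftSlope b S → x < y → y ≤ S → a x ℕ.< b x → b y ℕ.< a y → ⊥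
left-clash {a} {b} {x = x} {y} st ls x<y y≤S h₁ h₂ =
  slope-clash (+ a x) (+ a y) (+ b x) (+ b y) (y - x) (climb st (<⇒≤ x<y)) (ls x y x<y y≤S (<⇒0< h₁)) (pos-+1≤ h₁) (pos-+1≤ h₂)

right-clash : ∀ {a b S x y} → Stable a → RightSlope b S → S < x → x < y → b x ℕ.< a x → a y ℕ.< b y → ⊥
right-clash {a} {b} {x = x} {y} st rs S<x x<y h₁ h₂ =
  slope-clash (+ a y) (+ a x) (+ b y) (+ b x) (y - x) (fall st (<⇒≤ x<y)) (rs x y S<x x<y (<⇒0< h₂)) (pos-+1≤ h₂) (pos-+1≤ h₁)

-- The profile of a slope is within one grain of a staircase, so b cannot be above, below and again above a.
no-dip : ∀ {a b x y z} → Stable a → Slopes b → x < y → y < z →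
         a x ℕ.< b x → b y ℕ.< a y → a z ℕ.< b z → ⊥
no-dip {a} {b} {y = y} st (S , ls , rs) x<y y<z h₁ h₂ h₃ = split (y ≤? S)
  where
  split : Dec (y ≤ S) → ⊥
  split (yes y≤S) = left-clash {a} {b} st ls x<y y≤S h₁ h₂
  split (no y≰S) = right-clash {a} {b} st rs (≰⇒> y≰S) y<z h₂ h₃

-- Finite support and the lexicographic order

record Ends (n w : ℕ) (X : State) : Set where
  constructor mkEnds
  field
    pot-left  : ∀ k → k < - (+ w) → pot X k ≡ 0ℤ
    pot-right : ∀ k → + w ≤ k → pot X k ≡ + n
open Ends public

record Shape (n : ℕ) (X : State) : Set where
  field
    stable : Stable (cfg X)
    slopes : Slopes (cfg X)
    width  : ℕ
    ends   : Ends n width X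
open Shape public

far : ℕ → ℕ → ℤ → ℕ
far v w k = suc (v ℕ.+ w ℕ.+ ∣ k ∣)

i≤+∣i∣ : ∀ i → i ≤ + ∣ i ∣
i≤+∣i∣ (+ n) = ≤-refl
i≤+∣i∣ -[1+ n ] = ℤ.-≤+

far≥k : ∀ v w k → k ≤ + far v w k
far≥k v w k = ≤-trans (i≤+∣i∣ k) (+≤+ (ℕₚ.≤-trans (ℕₚ.m≤n+m ∣ k ∣ (v ℕ.+ w)) (ℕₚ.n≤1+n _)))

far>v : ∀ v w k → v ℕ.< far v w k
far>v v w k = ℕ.s≤s (ℕₚ.≤-trans (ℕₚ.m≤m+n v w) (ℕₚ.m≤m+n _ ∣ k ∣))

far>w : ∀ v w k → w ℕ.< far v w k
far>w v w k = ℕ.s≤s (ℕₚ.≤-trans (ℕₚ.m≤n+m w v) (ℕₚ.m≤m+n _ ∣ k ∣))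

-far≤k : ∀ v w k → - + far v w k ≤ k
-far≤k v w k = subst (- + far v w k ≤_) (neg-involutive k) (neg-mono-≤ (≤-trans (i≤+∣i∣ (- k)) (subst (λ m → + m ≤ + far v w k) (sym (∣-i∣≡∣i∣ k)) (+≤+ (ℕₚ.≤-trans (ℕₚ.m≤n+m ∣ k ∣ (v ℕ.+ w)) (ℕₚ.n≤1+n _))))))

module _ {n X Y v w} (eX : Ends n v X) (eY : Ends n w Y) where
  pot≡-left : ∀ k → pot X (- + far v w k) ≡ pot Y (- + far v w k)
  pot≡-left k = trans (pot-left eX _ (neg-mono-< (+<+ (far>v v w k)))) (sym (pot-left eY _ (neg-mono-< (+<+ (far>w v w k)))))

  pot≡-right : ∀ k → pot X (+ far v w k) ≡ pot Y (+ far v w k)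
  pot≡-right k = trans (pot-right eX _ (+≤+ (ℕₚ.<⇒≤ (far>v v w k)))) (sym (pot-right eY _ (+≤+ (ℕₚ.<⇒≤ (far>w v w k)))))

  pot≡-below : ∀ {i} → (∀ j → j < i → cfg X j ≡ cfg Y j) → ∀ k → k < i → pot X k ≡ pot Y k
  pot≡-below {i} eq k k<i with ≤⇒offset (-far≤k v w k)
  ... | m , k≡ = subst (λ k → pot X k ≡ pot Y k) (sym k≡) (go m (subst (_< i) k≡ k<i))
    where
    b = - + far v w k
    go : ∀ m → b + + m < i → pot X (b + + m) ≡ pot Y (b + + m)
    go zero _ = subst (λ k → pot X k ≡ pot Y k) (sym (+-identityʳ b)) (pot≡-left k)
    go (suc m) h = trans (pot-step X _) (trans (cong₂ (λ p c → p + + c)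
        (subst (λ k → pot X k ≡ pot Y k) (sym (k+suc-1 b m)) (go m (≤-<-trans (+-monoʳ-≤ b (+≤+ (ℕₚ.n≤1+n m))) h)))
        (eq _ h)) (sym (pot-step Y _)))

  lex⇒jump : ∀ {i} → cfg X i ℕ.< cfg Y i → (∀ j → j < i → cfg X j ≡ cfg Y j) → pot X i + 1ℤ ≤ pot Y i
  lex⇒jump {i} lt eq = lem (pot X i) (pot Y i) _ _ _ _ (pot-step X i) (pot-step Y i) (pot≡-below eq (i - 1ℤ) (k-1<k i)) (pos-+1≤ lt)
    where
    lem : ∀ x y x′ y′ c d → x ≡ x′ + c → y ≡ y′ + d → x′ ≡ y′ → c + 1ℤ ≤ d → x + 1ℤ ≤ y
    lem _ _ x′ _ c d refl refl refl h = linear h (solve (x′ ∷ c ∷ d ∷ []))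

  -- `Y` is ahead at the first difference `i`. Were it behind at a later `k`, some column in between
  -- would be lower in `Y`, and since the totals agree far to the right, a column after `k` would be
  -- higher again, contrary to `no-dip`.
  lex⇒≤ : Stable (cfg X) → Slopes (cfg Y) → cfg X <lex cfg Y → ∀ k → pot X k ≤ pot Y k
  lex⇒≤ st sl (i , lt , eq) k with pot X k ≤? pot Y k
  ... | yes h = h
  ... | no h with k <? i
  ...   | yes k<i = ≤-reflexive (pot≡-below eq k k<i)
  ...   | no k≮i = ⊥-elim contra
    where
    lem : ∀ xi yi xk yk → xi + 1ℤ ≤ yi → yk + 1ℤ ≤ xk → xi + yk + 1ℤ ≤ xk + yi
    lem xi yi xk yk h₁ h₂ = ≤-trans (i≤i+j _ 1ℤ) (linear (h₁ ⊕ h₂) (solve (xi ∷ yi ∷ xk ∷ yk ∷ [])))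
    lem₂ : ∀ xk yk e → yk + 1ℤ ≤ xk → yk + e + 1ℤ ≤ e + xk
    lem₂ xk yk e h = linear h (solve (xk ∷ yk ∷ e ∷ []))
    contra : ⊥
    contra with rise Y X (≮⇒≥ k≮i) (lem (pot X i) (pot Y i) (pot X k) (pot Y k) (lex⇒jump lt eq) (<⇒+1≤ (≰⇒> h)))
    ... | y , i<y , y≤k , d with rise X Y (far≥k v w k)
            (subst (λ e → pot Y k + pot X (+ far v w k) + 1ℤ ≤ e + pot X k) (pot≡-right k) (lem₂ (pot X k) (pot Y k) (pot X (+ far v w k)) (<⇒+1≤ (≰⇒> h))))
    ...   | z , k<z , _ , u = no-dip st sl i<y (≤-<-trans y≤k k<z) lt d u

pot≡⇒empty : ∀ X k → pot X k ≡ pot X (k - 1ℤ) → cfg X k ≡ 0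
pot≡⇒empty X k h = +-injective (lem (pot X k) (pot X (k - 1ℤ)) (+ cfg X k) (pot-step X k) h)
  where
  lem : ∀ p q c → p ≡ q + c → p ≡ q → c ≡ 0ℤ
  lem p q c h₁ refl = trans (sub p c) (trans (cong (λ z → z - p) (sym h₁)) (+-inverseʳ p))
    where
    sub : ∀ p c → c ≡ p + c - p
    sub p c = solve (p ∷ c ∷ [])

module _ {n X w} (e : Ends n w X) where
  empty-left : ∀ k → k < - + w → cfg X k ≡ 0
  empty-left k h = pot≡⇒empty X k (trans (pot-left e k h) (sym (pot-left e (k - 1ℤ) (<-trans (k-1<k k) h))))

  empty-right : ∀ k → + w < k → cfg X k ≡ 0
  empty-right k h = pot≡⇒empty X k (trans (pot-right e k (<⇒≤ h)) (sym (pot-right e (k - 1ℤ) (<⇒≤-1 h))))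

lex-compare : ∀ {n X Y v w} → Ends n v X → Ends n w Y →
              cfg X ≈c cfg Y ⊎ cfg X <lex cfg Y ⊎ cfg Y <lex cfg X
lex-compare {n} {X} {Y} {v} {w} eX eY = finish (search (f ℕ.+ f))
  where
  f = far v w 0ℤ
  b = - + f
  search : ∀ m → (∀ j → j < b + + m → cfg X j ≡ cfg Y j) ⊎ cfg X <lex cfg Y ⊎ cfg Y <lex cfg X
  search zero = inj₁ λ j j<b → let j<b′ = subst (j <_) (+-identityʳ b) j<b in
    trans (empty-left eX j (<-trans j<b′ (neg-mono-< (+<+ (far>v v w 0ℤ)))))
          (sym (empty-left eY j (<-trans j<b′ (neg-mono-< (+<+ (far>w v w 0ℤ))))))
  search (suc m) with search m
  ... | inj₂ r = inj₂ r
  ... | inj₁ eq with ℕₚ.<-cmp (cfg X (b + + m)) (cfg Y (b + + m))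
  ...   | tri< lt _ _ = inj₂ (inj₁ (_ , lt , eq))
  ...   | tri> _ _ gt = inj₂ (inj₂ (_ , gt , λ j h → sym (eq j h)))
  ...   | tri≈ _ e _ = inj₁ extend
    where
    extend : ∀ j → j < b + + suc m → cfg X j ≡ cfg Y j
    extend j h with <-cmp j (b + + m)
    ... | tri< l _ _ = eq j l
    ... | tri≈ _ refl _ = e
    ... | tri> _ _ g = ⊥-elim (<⇒≱ g (subst (j ≤_) (k+suc-1 b m) (<⇒≤-1 h)))
  b+2f : b + + (f ℕ.+ f) ≡ + f
  b+2f = trans (cong (λ z → b + z) (pos-+ f f)) (lem (+ f))
    where
    lem : ∀ f → - f + (f + f) ≡ f
    lem f = solve (f ∷ [])
  finish : (∀ j → j < b + + (f ℕ.+ f) → cfg X j ≡ cfg Y j) ⊎ cfg X <lex cfg Y ⊎ cfg Y <lex cfg X →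
           cfg X ≈c cfg Y ⊎ cfg X <lex cfg Y ⊎ cfg Y <lex cfg X
  finish (inj₂ r) = inj₂ r
  finish (inj₁ eq) = inj₁ all
    where
    all : ∀ j → cfg X j ≡ cfg Y j
    all j with j <? + f
    ... | yes h = eq j (subst (j <_) (sym b+2f) h)
    ... | no h = trans (empty-right eX j (<-≤-trans (+<+ (far>v v w 0ℤ)) (≮⇒≥ h)))
                       (sym (empty-right eY j (<-≤-trans (+<+ (far>w v w 0ℤ)) (≮⇒≥ h))))

-- Close stable configurations differ by one transported grain

module _ {n X Y v w} (eX : Ends n v X) (eY : Ends n w Y) (st : Stable (cfg X)) (sl : Slopes (cfg Y))
         (X<Y : cfg X <lex cfg Y) (close : ∀ k → pot Y k ≤ pot X k + 1ℤ) where
  private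
    i = proj₁ X<Y
    lt = proj₁ (proj₂ X<Y)
    eq = proj₂ (proj₂ X<Y)

    dom : ∀ k → pot X k ≤ pot Y k
    dom = lex⇒≤ eX eY st sl X<Y

    jump : pot X i + 1ℤ ≤ pot Y i
    jump = lex⇒jump eX eY lt eq

    cross : ∀ a b c d → a + 1ℤ ≤ b → c ≤ d → a + c + 1ℤ ≤ d + b
    cross a b c d h₁ h₂ = linear (h₁ ⊕ h₂) (solve (a ∷ b ∷ c ∷ d ∷ []))

    cross′ : ∀ a b c d → a ≤ b → c + 1ℤ ≤ d → a + c + 1ℤ ≤ d + b
    cross′ a b c d h₁ h₂ = linear (h₁ ⊕ h₂) (solve (a ∷ b ∷ c ∷ d ∷ []))

    before-rise : ∀ {m} → cfg X m ℕ.< cfg Y m → pot Y (m - 1ℤ) ≤ pot X (m - 1ℤ)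
    before-rise {m} h = lem (pot X m) (pot Y m) (pot X (m - 1ℤ)) (pot Y (m - 1ℤ)) _ _ (pot-step X m) (pot-step Y m) (close m) (pos-+1≤ h)
      where
      lem : ∀ x y x′ y′ c d → x ≡ x′ + c → y ≡ y′ + d → y ≤ x + 1ℤ → c + 1ℤ ≤ d → y′ ≤ x′
      lem _ _ x′ y′ c d refl refl h₁ h₂ = linear (h₁ ⊕ h₂) (solve (x′ ∷ y′ ∷ c ∷ d ∷ []))

    before-drop : ∀ {m} → cfg Y m ℕ.< cfg X m → pot X (m - 1ℤ) + 1ℤ ≤ pot Y (m - 1ℤ)
    before-drop {m} h = lem (pot X m) (pot Y m) (pot X (m - 1ℤ)) (pot Y (m - 1ℤ)) _ _ (pot-step X m) (pot-step Y m) (dom m) (pos-+1≤ h)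
      where
      lem : ∀ x y x′ y′ c d → x ≡ x′ + c → y ≡ y′ + d → x ≤ y → d + 1ℤ ≤ c → x′ + 1ℤ ≤ y′
      lem _ _ x′ y′ c d refl refl h₁ h₂ = linear (h₁ ⊕ h₂) (solve (x′ ∷ y′ ∷ c ∷ d ∷ []))

    after-drop : ∀ {m} → cfg Y m ℕ.< cfg X m → pot Y m ≤ pot X m
    after-drop {m} h = lem (pot X m) (pot Y m) (pot X (m - 1ℤ)) (pot Y (m - 1ℤ)) _ _ (pot-step X m) (pot-step Y m) (close (m - 1ℤ)) (pos-+1≤ h)
      where
      lem : ∀ x y x′ y′ c d → x ≡ x′ + c → y ≡ y′ + d → y′ ≤ x′ + 1ℤ → d + 1ℤ ≤ c → y ≤ x
      lem _ _ x′ y′ c d refl refl h₁ h₂ = linear (h₁ ⊕ h₂) (solve (x′ ∷ y′ ∷ c ∷ d ∷ []))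

    rise-by-1 : ∀ {m} → cfg X m ℕ.< cfg Y m → cfg Y m ≡ suc (cfg X m)
    rise-by-1 {m} h = ℕₚ.≤-antisym (drop‿+≤+ (lem (pot X m) (pot Y m) (pot X (m - 1ℤ)) (pot Y (m - 1ℤ)) (+ cfg X m) (+ cfg Y m)
                        (pot-step X m) (pot-step Y m) (dom (m - 1ℤ)) (close m))) h
      where
      lem : ∀ x y x′ y′ c d → x ≡ x′ + c → y ≡ y′ + d → x′ ≤ y′ → y ≤ x + 1ℤ → d ≤ 1ℤ + c
      lem _ _ x′ y′ c d refl refl h₁ h₂ = linear (h₁ ⊕ h₂) (solve (x′ ∷ y′ ∷ c ∷ d ∷ []))

    drop-by-1 : ∀ {m} → cfg Y m ℕ.< cfg X m → cfg X m ≡ suc (cfg Y m)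
    drop-by-1 {m} h = ℕₚ.≤-antisym (drop‿+≤+ (lem (pot X m) (pot Y m) (pot X (m - 1ℤ)) (pot Y (m - 1ℤ)) (+ cfg X m) (+ cfg Y m)
                        (pot-step X m) (pot-step Y m) (dom m) (close (m - 1ℤ)))) h
      where
      lem : ∀ x y x′ y′ c d → x ≡ x′ + c → y ≡ y′ + d → x ≤ y → y′ ≤ x′ + 1ℤ → c ≤ 1ℤ + d
      lem _ _ x′ y′ c d refl refl h₁ h₂ = linear (h₁ ⊕ h₂) (solve (x′ ∷ y′ ∷ c ∷ d ∷ []))

    -- The difference of potentials is 1 at `i` and 0 just before a second rise, so a drop lies in
    -- between: a dip.
    one-rise : ∀ {m} → i < m → cfg X m ℕ.< cfg Y m → ⊥
    one-rise {m} i<m h with rise Y X (<⇒≤-1 i<m)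
      (cross (pot X i) (pot Y i) (pot Y (m - 1ℤ)) (pot X (m - 1ℤ)) jump (before-rise h))
    ... | y , i<y , y≤ , d = no-dip st sl i<y (≤-<-trans y≤ (k-1<k m)) lt d h

    one-drop : ∀ {p q} → i < p → p < q → cfg Y p ℕ.< cfg X p → cfg Y q ℕ.< cfg X q → ⊥
    one-drop {p} {q} i<p p<q h₁ h₂ with rise X Y (<⇒≤-1 p<q)
      (cross′ (pot Y p) (pot X p) (pot X (q - 1ℤ)) (pot Y (q - 1ℤ)) (after-drop h₁) (before-drop h₂))
    ... | z , p<z , z≤ , u = no-dip st sl i<p p<z lt h₁ u

  -- The difference of potentials takes only the values 0 and 1. It leaves 0 at `i` and must return
  -- to 0 by the far right, which yields the drop `j`; a second rise or drop would create a dip.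
  lex∧close⇒◁ : cfg X ◁ cfg Y
  lex∧close⇒◁ with rise Y X (far≥k v w i)
    (cross (pot X i) (pot Y i) (pot Y (+ far v w i)) (pot X (+ far v w i)) jump (≤-reflexive (sym (pot≡-right eX eY i))))
  ... | j , i<j , _ , d = i , j , i<j , rise-by-1 lt , drop-by-1 d , rest
    where
    rest : ∀ m → m ≢ i → m ≢ j → cfg X m ≡ cfg Y m
    rest m m≢i m≢j with <-cmp m i
    ... | tri< m<i _ _ = eq m m<i
    ... | tri≈ _ m≡i _ = ⊥-elim (m≢i m≡i)
    ... | tri> _ _ i<m with ℕₚ.<-cmp (cfg X m) (cfg Y m)
    ...   | tri≈ _ e _ = e
    ...   | tri< u _ _ = ⊥-elim (one-rise i<m u)
    ...   | tri> _ _ d′ with <-cmp m j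
    ...     | tri< m<j _ _ = ⊥-elim (one-drop i<m m<j d′ d)
    ...     | tri≈ _ m≡j _ = ⊥-elim (m≢j m≡j)
    ...     | tri> _ _ j<m = ⊥-elim (one-drop i<j j<m d d′)

-- Let `x` and `q` be the first columns where `U` and `P`, respectively `P` and `V`, differ. The
-- order of the sites forces `x < q` and `U` not below `P` at `q`, so `U` exceeds `P` in a column
-- `z` up to `q`. If `z` is on the left slope of `P`, the stable `U` climbs too fast; otherwise `V`,
-- higher than `P` at `q` and lower later, falls too fast.
no-crossing : ∀ {n U P V} → Shape n U → Shape n P → Shape n V →
              cfg U <lex cfg P → cfg P <lex cfg V →
              ¬ (∀ m q → pot U m < pot P m → pot P q < pot V q → m < q)
no-crossing {U = U} {P} {V} sU sP sV (x , lt₁ , eq₁) (q , lt₂ , eq₂) J = split (z ≤? proj₁ (slopes sP))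
  where
  U<P : pot U x + 1ℤ ≤ pot P x
  U<P = lex⇒jump (ends sU) (ends sP) lt₁ eq₁
  P<V : pot P q + 1ℤ ≤ pot V q
  P<V = lex⇒jump (ends sP) (ends sV) lt₂ eq₂
  x<q : x < q
  x<q = J x q (+1≤⇒< U<P) (+1≤⇒< P<V)
  P≤U : pot P q ≤ pot U q
  P≤U = ≮⇒≥ (λ h → <-irrefl refl (J q q h (+1≤⇒< P<V)))
  cross : ∀ a b c d → a + 1ℤ ≤ b → c ≤ d → a + c + 1ℤ ≤ d + b
  cross a b c d h₁ h₂ = linear (h₁ ⊕ h₂) (solve (a ∷ b ∷ c ∷ d ∷ []))
  up : ∃ λ z → x < z × z ≤ q × cfg P z ℕ.< cfg U z
  up = rise P U (<⇒≤ x<q) (cross (pot U x) (pot P x) (pot P q) (pot U q) U<P P≤U)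
  F = + far (width sP) (width sV) q
  down : ∃ λ y → q < y × y ≤ F × cfg V y ℕ.< cfg P y
  down = rise V P (far≥k (width sP) (width sV) q)
    (cross (pot P q) (pot V q) (pot V F) (pot P F) P<V (≤-reflexive (sym (pot≡-right (ends sP) (ends sV) q))))
  z = proj₁ up
  split : Dec (z ≤ proj₁ (slopes sP)) → ⊥
  split (yes h) = left-clash (stable sU) (proj₁ (proj₂ (slopes sP))) (proj₁ (proj₂ up)) h lt₁ (proj₂ (proj₂ (proj₂ up)))
  split (no h) = right-clash (stable sV) (proj₂ (proj₂ (slopes sP))) (<-≤-trans (≰⇒> h) (proj₁ (proj₂ (proj₂ up))))
    (proj₁ (proj₂ down)) lt₂ (proj₂ (proj₂ (proj₂ down)))

-- Moves of potentials relative to a fixed flat potential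

-- Site k lies between the columns k and k + 1.
data Site (A A′ : ℤ → ℤ) (k : ℤ) : Set where
  up   : A′ k ≡ A k + 1ℤ → A k + A k + + 2 ≤ A (k - 1ℤ) + A (k + 1ℤ) → Site A A′ k
  stay : A′ k ≡ A k → Site A A′ k
  down : A′ k + 1ℤ ≡ A k → A (k - 1ℤ) + A (k + 1ℤ) + + 2 ≤ A k + A k → Site A A′ k

-- `peak` excludes a column that fires to both sides, `valley` one that receives from both sides.
record Move (A A′ : ℤ → ℤ) : Set where
  field
    site   : ∀ k → Site A A′ k
    peak   : ∀ k → A k < A′ k → A′ (k + 1ℤ) < A (k + 1ℤ) → ⊥
    valley : ∀ k → A′ k < A k → A (k + 1ℤ) < A′ (k + 1ℤ) → ⊥
open Move public

record Flat (P : ℤ → ℤ) : Set where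
  field
    flat-up   : ∀ k → P (k - 1ℤ) + P (k + 1ℤ) ≤ P k + P k + 1ℤ
    flat-down : ∀ k → P k + P k ≤ P (k - 1ℤ) + P (k + 1ℤ) + 1ℤ
open Flat public

neg : (ℤ → ℤ) → ℤ → ℤ
neg A k = - A k

-- Negation exchanges `up` with `down` and `peak` with `valley`, so that results on sites below a
-- flat potential also serve for sites above it.
neg-move : ∀ {A A′} → Move A A′ → Move (neg A) (neg A′)
neg-move {A} {A′} mv = record
  { site = λ k → flip (site mv k)
  ; peak = λ k h₁ h₂ → valley mv k (neg-cancel-< h₁) (neg-cancel-< h₂)
  ; valley = λ k h₁ h₂ → peak mv k (neg-cancel-< h₁) (neg-cancel-< h₂)
  }
  where
  lem₁ : ∀ a′ a → a′ ≡ a + 1ℤ → - a′ + 1ℤ ≡ - a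
  lem₁ _ a refl = solve (a ∷ [])
  lem₂ : ∀ a′ a → a′ + 1ℤ ≡ a → - a′ ≡ - a + 1ℤ
  lem₂ a′ _ refl = solve (a′ ∷ [])
  lem₃ : ∀ a b c → a + a + + 2 ≤ b + c → - b + - c + + 2 ≤ - a + - a
  lem₃ a b c h = linear h (solve (a ∷ b ∷ c ∷ []))
  lem₄ : ∀ a b c → b + c + + 2 ≤ a + a → - a + - a + + 2 ≤ - b + - c
  lem₄ a b c h = linear h (solve (a ∷ b ∷ c ∷ []))
  flip : ∀ {k} → Site A A′ k → Site (neg A) (neg A′) k
  flip {k} (up e h) = down (lem₁ _ (A k) e) (lem₃ (A k) (A (k - 1ℤ)) (A (k + 1ℤ)) h)
  flip (stay e) = stay (cong -_ e)
  flip {k} (down e h) = up (lem₂ (A′ k) _ e) (lem₄ (A k) (A (k - 1ℤ)) (A (k + 1ℤ)) h)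

neg-flat : ∀ {P} → Flat P → Flat (neg P)
neg-flat {P} fl = record
  { flat-up = λ k → lem₁ (P k) (P (k - 1ℤ)) (P (k + 1ℤ)) (flat-down fl k)
  ; flat-down = λ k → lem₂ (P k) (P (k - 1ℤ)) (P (k + 1ℤ)) (flat-up fl k)
  }
  where
  lem₁ : ∀ a b c → a + a ≤ b + c + 1ℤ → - b + - c ≤ - a + - a + 1ℤ
  lem₁ a b c h = linear h (solve (a ∷ b ∷ c ∷ []))
  lem₂ : ∀ a b c → b + c ≤ a + a + 1ℤ → - a + - a ≤ - b + - c + 1ℤ
  lem₂ a b c h = linear h (solve (a ∷ b ∷ c ∷ []))

-- The interval of sites below a flat potential

Convex : (ℤ → ℤ) → (ℤ → ℤ) → Set
Convex A P = ∀ i j k → i < j → j < k → A i < P i → A k < P k → A j < P j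

module _ {A A′ P : ℤ → ℤ} (fl : Flat P) (mv : Move A A′) where
  -- Leaving would need `A k = P k - 1` and an `up`, hence a second difference of at least 2. But
  -- with both neighbours below `P`, it is at most that of `P`, which is at most 1.
  interior : ∀ k → A (k - 1ℤ) < P (k - 1ℤ) → A k < P k → A (k + 1ℤ) < P (k + 1ℤ) → A′ k < P k
  interior k h₋ h h₊ with site mv k
  ... | stay e = subst (_< P k) (sym e) h
  ... | down e _ = <-trans (+1≤⇒< (≤-reflexive e)) h
  ... | up e c = ≰⇒> (lem (A k) (A (k - 1ℤ)) (A (k + 1ℤ)) (P k) (P (k - 1ℤ)) (P (k + 1ℤ)) (A′ k) e c
                   (<⇒+1≤ h₋) (<⇒+1≤ h₊) (flat-up fl k))
    where
    lem : ∀ a a₋ a₊ p p₋ p₊ a′ → a′ ≡ a + 1ℤ → a + a + + 2 ≤ a₋ + a₊ → a₋ + 1ℤ ≤ p₋ → a₊ + 1ℤ ≤ p₊ →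
          p₋ + p₊ ≤ p + p + 1ℤ → ¬ (p ≤ a′)
    lem a a₋ a₊ p p₋ p₊ _ refl h₁ h₂ h₃ h₄ h₅ =
      refute 0 (h₁ ⊕ h₂ ⊕ h₃ ⊕ h₄ ⊕ h₅ ⊕ h₅) (solve (a ∷ a₋ ∷ a₊ ∷ p ∷ p₋ ∷ p₊ ∷ []))

  -- Entering takes a `down` from `A k = P k`, hence a second difference of at most -2. With neither
  -- neighbour below `P` it would be at least that of `P`, which is at least -1.
  fresh : ∀ k → A′ k < P k → P k ≤ A k →
          A′ k < A k × (A (k - 1ℤ) < P (k - 1ℤ) ⊎ A (k + 1ℤ) < P (k + 1ℤ))
  fresh k h g with A (k - 1ℤ) <? P (k - 1ℤ) | A (k + 1ℤ) <? P (k + 1ℤ)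
  ... | yes l | _ = <-≤-trans h g , inj₁ l
  ... | no _ | yes r = <-≤-trans h g , inj₂ r
  ... | no l | no r with site mv k
  ...   | up e _ = ⊥-elim (<⇒≱ h (≤-trans g (≤-trans (i≤i+j (A k) 1ℤ) (≤-reflexive (sym e)))))
  ...   | stay e = ⊥-elim (<⇒≱ h (≤-trans g (≤-reflexive (sym e))))
  ...   | down e c = ⊥-elim (lem (A k) (A (k - 1ℤ)) (A (k + 1ℤ)) (P k) (P (k - 1ℤ)) (P (k + 1ℤ)) (A′ k) e c
                       (<⇒+1≤ h) (≮⇒≥ l) (≮⇒≥ r) (flat-down fl k))
    where
    lem : ∀ a a₋ a₊ p p₋ p₊ a′ → a′ + 1ℤ ≡ a → a₋ + a₊ + + 2 ≤ a + a → a′ + 1ℤ ≤ p → p₋ ≤ a₋ → p₊ ≤ a₊ →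
          p + p ≤ p₋ + p₊ + 1ℤ → ⊥
    lem _ a₋ a₊ p p₋ p₊ a′ refl h₁ h₂ h₃ h₄ h₅ =
      refute 0 (h₁ ⊕ h₂ ⊕ h₂ ⊕ h₃ ⊕ h₄ ⊕ h₅) (solve (a′ ∷ a₋ ∷ a₊ ∷ p ∷ p₋ ∷ p₊ ∷ []))

  kept-right : ∀ k → A′ k < A k → A (k + 1ℤ) < P (k + 1ℤ) → A′ (k + 1ℤ) < P (k + 1ℤ)
  kept-right k f h = ≰⇒> λ g → valley mv k f (<-≤-trans h g)

  kept-left : ∀ k → A′ k < A k → A (k - 1ℤ) < P (k - 1ℤ) → A′ (k - 1ℤ) < P (k - 1ℤ)
  kept-left k f h = ≰⇒> λ g → peak mv (k - 1ℤ) (<-≤-trans h g)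
    (subst (λ j → A′ j < A j) (sym (k-1+1 k)) f)

  -- A site that has just entered did so by moving down beside an old member; that neighbour cannot
  -- move up at the same time and stays a member.
  shared : ∀ k → A′ k < P k → ∃ λ j → A j < P j × A′ j < P j
  shared k h with A k <? P k
  ... | yes g = k , g , h
  ... | no g with fresh k h (≮⇒≥ g)
  ...   | f , inj₁ l = k - 1ℤ , l , kept-left k f l
  ...   | f , inj₂ r = k + 1ℤ , r , kept-right k f r

  -- A gap `j` between new members has old members on both sides: a new member is old or entered
  -- beside an old one, and that one is not `j`, which would have been kept. So `j - 1`, `j` and
  -- `j + 1` were members, and `interior` keeps `j`.
  convex-move : Convex A P → Convex A′ P
  convex-move cv i j k i<j j<k hi hk with A′ j <? P j
  ... | yes h = h
  ... | no h = ⊥-elim (h (interior j (between (j - 1ℤ) (<⇒≤-1 i′<j) (<-trans (k-1<k j) j<k′))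
                                     (cv _ _ _ i′<j j<k′ hi′ hk′)
                                     (between′ (j + 1ℤ) (<⇒+1≤ j<k′) (<-trans i′<j (k<k+1 j)))))
    where
    lower : ∃ λ i′ → i′ < j × A i′ < P i′
    lower with A i <? P i
    ... | yes g = i , i<j , g
    ... | no g with fresh i hi (≮⇒≥ g)
    ...   | _ , inj₁ l = i - 1ℤ , <-trans (k-1<k i) i<j , l
    ...   | f , inj₂ r with <-cmp (i + 1ℤ) j
    ...     | tri< lt _ _ = i + 1ℤ , lt , r
    ...     | tri≈ _ refl _ = ⊥-elim (h (kept-right i f r))
    ...     | tri> _ _ gt = ⊥-elim (<⇒≱ gt (<⇒+1≤ i<j))
    upper : ∃ λ k′ → j < k′ × A k′ < P k′
    upper with A k <? P k
    ... | yes g = k , j<k , g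
    ... | no g with fresh k hk (≮⇒≥ g)
    ...   | _ , inj₂ r = k + 1ℤ , <-trans j<k (k<k+1 k) , r
    ...   | f , inj₁ l with <-cmp j (k - 1ℤ)
    ...     | tri< lt _ _ = k - 1ℤ , lt , l
    ...     | tri≈ _ refl _ = ⊥-elim (h (kept-left k f l))
    ...     | tri> _ _ gt = ⊥-elim (<⇒≱ gt (<⇒≤-1 j<k))
    i′ = proj₁ lower
    k′ = proj₁ upper
    i′<j = proj₁ (proj₂ lower)
    j<k′ = proj₁ (proj₂ upper)
    hi′ = proj₂ (proj₂ lower)
    hk′ = proj₂ (proj₂ upper)
    between : ∀ m → i′ ≤ m → m < k′ → A m < P m
    between m i≤m m<k with <-cmp i′ m
    ... | tri< lt _ _ = cv _ _ _ lt m<k hi′ hk′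
    ... | tri≈ _ refl _ = hi′
    ... | tri> _ _ gt = ⊥-elim (<⇒≱ gt i≤m)
    between′ : ∀ m → m ≤ k′ → i′ < m → A m < P m
    between′ m m≤k i<m with <-cmp m k′
    ... | tri< lt _ _ = cv _ _ _ i<m lt hi′ hk′
    ... | tri≈ _ refl _ = hk′
    ... | tri> _ _ gt = ⊥-elim (<⇒≱ gt m≤k)

-- Close pairs on the two sides of a flat potential

Close : (ℤ → ℤ) → (ℤ → ℤ) → Set
Close A B = ∀ k → A k ≤ B k + 1ℤ × B k ≤ A k + 1ℤ

Ordered : (ℤ → ℤ) → (ℤ → ℤ) → (ℤ → ℤ) → Set
Ordered P A B = ∀ m q → A m < P m → P q < B q → m < q

close⇒apart : ∀ {A B} → Close A B → ∀ (P : ℤ → ℤ) k → A k < P k → P k < B k → ⊥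
close⇒apart {A} {B} close P k h₁ h₂ = lem (A k) (P k) (B k) (<⇒+1≤ h₁) (<⇒+1≤ h₂) (proj₂ (close k))
  where
  lem : ∀ a p b → a + 1ℤ ≤ p → p + 1ℤ ≤ b → b ≤ a + 1ℤ → ⊥
  lem a p b h₁ h₂ h₃ = refute 0 (h₁ ⊕ h₂ ⊕ h₃) (solve (a ∷ p ∷ b ∷ []))

-- The sites of A below P and those of B above P form intervals that share a site with their successors and are
-- kept disjoint by closeness, so they cannot swap.
ordered-move : ∀ {P A A′ B B′} → Flat P → Move A A′ → Move B B′ →
               Convex A′ P → Convex (neg B′) (neg P) → Close A′ B′ →
               Ordered P A B → Ordered P A′ B′
ordered-move {P} {A} {A′} {B} {B′} fl mA mB cA cB close ord m q hm hq with <-cmp m q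
... | tri< lt _ _ = lt
... | tri≈ _ refl _ = ⊥-elim (close⇒apart close P m hm hq)
... | tri> _ _ q<m with shared fl mA m hm | shared (neg-flat fl) (neg-move mB) q (neg-mono-< hq)
...   | m₀ , h₁ , h₂ | q₀ , g₁ , g₂ = ⊥-elim contra
  where
  m₀<q₀ : m₀ < q₀
  m₀<q₀ = ord m₀ q₀ h₁ (neg-cancel-< g₁)
  contra : ⊥
  -- As `q < m` but `m₀ < q₀`, either `m` lies in the interval from `q` to `q₀` or `q₀` in the one
  -- from `m₀` to `m`; that site is then both below and above `P`.
  contra with <-cmp m q₀
  ... | tri< m<q₀ _ _ = close⇒apart close P m hm (neg-cancel-< (cB q m q₀ q<m m<q₀ (neg-mono-< hq) g₂))
  ... | tri≈ _ refl _ = close⇒apart close P m hm (neg-cancel-< g₂)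
  ... | tri> _ _ q₀<m = close⇒apart close P q₀ (cA m₀ q₀ m m₀<q₀ q₀<m h₂ hm) (neg-cancel-< g₂)

-- Steps as flows through the sites

-- `stay` carries no condition, so that sequential steps, which leave most sites at rest, are
-- covered together with parallel ones.
data Dir (a : Config) (k : ℤ) : ℤ → Set where
  up   : a k ℕ.+ 2 ℕ.≤ a (k + 1ℤ) → Dir a k 1ℤ
  stay : Dir a k 0ℤ
  down : a (k + 1ℤ) ℕ.+ 2 ℕ.≤ a k → Dir a k -1ℤ

record Flow (X Y : State) : Set where
  field
    s        : ℤ → ℤ
    pot-flow : ∀ k → pot Y k ≡ pot X k + s k
    dir      : ∀ k → Dir (cfg X) k (s k)
    no-split : ∀ k → s k ≡ 1ℤ → s (k + 1ℤ) ≡ -1ℤ → ⊥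

  cfg-flow : ∀ k → + cfg Y k ≡ + cfg X k + s k - s (k - 1ℤ)
  cfg-flow k = lem (+ cfg Y k) (+ cfg X k) (s k) (s (k - 1ℤ)) (pot X (k - 1ℤ)) (pot Y (k - 1ℤ)) (pot-flow (k - 1ℤ))
    (trans (sym (pot-step Y k)) (trans (pot-flow k) (cong (λ z → z + s k) (pot-step X k))))
    where
    drop : ∀ d p → d ≡ p + d - p
    drop d p = solve (d ∷ p ∷ [])
    fin : ∀ c s s′ x → x + c + s - (x + s′) ≡ c + s - s′
    fin c s s′ x = solve (c ∷ s ∷ s′ ∷ x ∷ [])
    lem : ∀ d c s s′ x y → y ≡ x + s′ → y + d ≡ x + c + s → d ≡ c + s - s′
    lem d c s s′ x _ refl h = trans (drop d (x + s′)) (trans (cong (λ z → z - (x + s′)) h) (fin c s s′ x))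
open Flow public

+2≤⇒0< : ∀ {m n} → m ℕ.+ 2 ℕ.≤ n → 0 ℕ.< n
+2≤⇒0< {m} h = ℕₚ.≤-trans (ℕₚ.≤-trans (ℕ.s≤s ℕ.z≤n) (ℕₚ.m≤n+m 2 m)) h

-- Invariance of slopes under flows

module _ {a : Config} {S : ℤ} (ls : LeftSlope a S) where
  left-weak : ∀ x y → x ≤ y → y ≤ S → 0 ℕ.< a x → + a x + (y - x) ≤ + a y + 1ℤ
  left-weak x y x≤y y≤S h with <-cmp x y
  ... | tri< lt _ _ = ls x y lt y≤S h
  ... | tri≈ _ refl _ = ≤-trans (≤-reflexive (lem x (+ a x))) (i≤i+j (+ a x) 1ℤ)
    where
    lem : ∀ x c → c + (x - x) ≡ c
    lem x c = solve (x ∷ c ∷ [])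
  ... | tri> _ _ gt = ⊥-elim (<⇒≱ gt x≤y)

  left-no-fall : ∀ k → k + 1ℤ ≤ S → ¬ (a (k + 1ℤ) ℕ.+ 2 ℕ.≤ a k)
  left-no-fall k k<S h = lem k (+ a k) (+ a (k + 1ℤ)) (pos-+2≤ h) (ls k (k + 1ℤ) (k<k+1 k) k<S (+2≤⇒0< h))
    where
    lem : ∀ k c d → d + + 2 ≤ c → c + (k + 1ℤ - k) ≤ d + 1ℤ → ⊥
    lem k c d h₁ h₂ = refute 1 (h₁ ⊕ h₂) (solve (k ∷ c ∷ d ∷ []))

module _ {a : Config} {S : ℤ} (rs : RightSlope a S) where
  right-weak : ∀ x y → S < x → x ≤ y → 0 ℕ.< a y → + a y + (y - x) ≤ + a x + 1ℤ
  right-weak x y S<x x≤y h with <-cmp x y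
  ... | tri< lt _ _ = rs x y S<x lt h
  ... | tri≈ _ refl _ = ≤-trans (≤-reflexive (lem x (+ a x))) (i≤i+j (+ a x) 1ℤ)
    where
    lem : ∀ x c → c + (x - x) ≡ c
    lem x c = solve (x ∷ c ∷ [])
  ... | tri> _ _ gt = ⊥-elim (<⇒≱ gt x≤y)

  right-no-rise : ∀ k → S < k → ¬ (a k ℕ.+ 2 ℕ.≤ a (k + 1ℤ))
  right-no-rise k S<k h = lem k (+ a (k + 1ℤ)) (+ a k) (pos-+2≤ h) (rs k (k + 1ℤ) S<k (k<k+1 k) (+2≤⇒0< h))
    where
    lem : ∀ k c d → d + + 2 ≤ c → c + (k + 1ℤ - k) ≤ d + 1ℤ → ⊥
    lem k c d h₁ h₂ = refute 1 (h₁ ⊕ h₂) (solve (k ∷ c ∷ d ∷ []))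

Dir-unique : ∀ {a k t} → Dir a k t → t ≡ 0ℤ ⊎ (t ≡ 1ℤ × a k ℕ.+ 2 ℕ.≤ a (k + 1ℤ)) ⊎ (t ≡ -1ℤ × a (k + 1ℤ) ℕ.+ 2 ℕ.≤ a k)
Dir-unique (up h) = inj₂ (inj₁ (refl , h))
Dir-unique stay = inj₁ refl
Dir-unique (down h) = inj₂ (inj₂ (refl , h))

module _ (X : State) (k : ℤ) where
  private
    a = cfg X
    A = pot X

  -- The second difference of the potential at `k` is `a (k + 1) - a k`; the next three lemmas use
  -- the same identity.
  rise⇒pot : a k ℕ.+ 2 ℕ.≤ a (k + 1ℤ) → A k + A k + + 2 ≤ A (k - 1ℤ) + A (k + 1ℤ)
  rise⇒pot h = lem _ (A (k - 1ℤ)) _ (+ a k) (+ a (k + 1ℤ)) (pot-step X k) (pot-next X k) (pos-+2≤ h)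
    where
    lem : ∀ p p₋ p₊ c d → p ≡ p₋ + c → p₊ ≡ p + d → c + + 2 ≤ d → p + p + + 2 ≤ p₋ + p₊
    lem _ p₋ _ c d refl refl h = linear h (solve (p₋ ∷ c ∷ d ∷ []))

  fall⇒pot : a (k + 1ℤ) ℕ.+ 2 ℕ.≤ a k → A (k - 1ℤ) + A (k + 1ℤ) + + 2 ≤ A k + A k
  fall⇒pot h = lem _ (A (k - 1ℤ)) _ (+ a k) (+ a (k + 1ℤ)) (pot-step X k) (pot-next X k) (pos-+2≤ h)
    where
    lem : ∀ p p₋ p₊ c d → p ≡ p₋ + c → p₊ ≡ p + d → d + + 2 ≤ c → p₋ + p₊ + + 2 ≤ p + p
    lem _ p₋ _ c d refl refl h = linear h (solve (p₋ ∷ c ∷ d ∷ []))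

  pot⇒rise : A k + A k + + 2 ≤ A (k - 1ℤ) + A (k + 1ℤ) → a k ℕ.+ 2 ℕ.≤ a (k + 1ℤ)
  pot⇒rise h = drop‿+≤+ (lem _ (A (k - 1ℤ)) _ (+ a k) (+ a (k + 1ℤ)) (pot-step X k) (pot-next X k) h)
    where
    lem : ∀ p p₋ p₊ c d → p ≡ p₋ + c → p₊ ≡ p + d → p + p + + 2 ≤ p₋ + p₊ → c + + 2 ≤ d
    lem _ p₋ _ c d refl refl h = linear h (solve (p₋ ∷ c ∷ d ∷ []))

  pot⇒fall : A (k - 1ℤ) + A (k + 1ℤ) + + 2 ≤ A k + A k → a (k + 1ℤ) ℕ.+ 2 ℕ.≤ a k
  pot⇒fall h = drop‿+≤+ (lem _ (A (k - 1ℤ)) _ (+ a k) (+ a (k + 1ℤ)) (pot-step X k) (pot-next X k) h)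
    where
    lem : ∀ p p₋ p₊ c d → p ≡ p₋ + c → p₊ ≡ p + d → p₋ + p₊ + + 2 ≤ p + p → d + + 2 ≤ c
    lem _ p₋ _ c d refl refl h = linear h (solve (p₋ ∷ c ∷ d ∷ []))

module _ {X Y : State} (fl : Flow X Y) where
  private
    a = cfg X
    σ = s fl

  -- Shifting the split past a firing site makes the new split site idle.
  resplit : Slopes a → ∃ λ S → LeftSlope a S × RightSlope a S × σ S ≡ 0ℤ
  resplit (S , ls , rs) with Dir-unique (dir fl S)
  ... | inj₁ z = S , ls , rs , z
  ... | inj₂ (inj₁ (e , h)) = S + 1ℤ , ls′ , (λ x y S<x → rs x y (<-trans (k<k+1 S) S<x)) , idle
    where
    ls′ : LeftSlope a (S + 1ℤ)
    ls′ x y x<y y≤ 0<x with <-cmp y (S + 1ℤ)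
    ... | tri< lt _ _ = ls x y x<y (subst (y ≤_) (k+1-1 S) (<⇒≤-1 lt)) 0<x
    ... | tri> _ _ gt = ⊥-elim (<⇒≱ gt y≤)
    ... | tri≈ _ refl _ = lem (+ a x) x S (+ a S) (+ a (S + 1ℤ)) (pos-+2≤ h)
                            (left-weak ls x S (subst (x ≤_) (k+1-1 S) (<⇒≤-1 x<y)) ≤-refl 0<x)
      where
      lem : ∀ c x S d e → d + + 2 ≤ e → c + (S - x) ≤ d + 1ℤ → c + (S + 1ℤ - x) ≤ e + 1ℤ
      lem c x S d e h₁ h₂ = ≤-trans (i≤i+j _ 1ℤ) (linear (h₁ ⊕ h₂) (solve (c ∷ x ∷ S ∷ d ∷ e ∷ [])))
    -- Column `S + 1` already fires left, so it cannot fire right, and an upward flow would need a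
    -- rise on the right slope.
    idle : σ (S + 1ℤ) ≡ 0ℤ
    idle with Dir-unique (dir fl (S + 1ℤ))
    ... | inj₁ z = z
    ... | inj₂ (inj₁ (_ , r)) = ⊥-elim (right-no-rise {a} rs (S + 1ℤ) (k<k+1 S) r)
    ... | inj₂ (inj₂ (r , _)) = ⊥-elim (no-split fl S e r)
  ... | inj₂ (inj₂ (e , h)) = S - 1ℤ , (λ x y x<y y≤ → ls x y x<y (≤-trans y≤ (<⇒≤ (k-1<k S)))) , rs′ , idle
    where
    rs′ : RightSlope a (S - 1ℤ)
    rs′ x y S<x x<y 0<y with <-cmp S x
    ... | tri< lt _ _ = rs x y lt x<y 0<y
    ... | tri> _ _ gt = ⊥-elim (<⇒≱ gt (subst (_≤ x) (k-1+1 S) (<⇒+1≤ S<x)))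
    ... | tri≈ _ refl _ = lem (+ a y) y S (+ a S) (+ a (S + 1ℤ)) (pos-+2≤ h)
                            (right-weak rs (S + 1ℤ) y (k<k+1 S) (<⇒+1≤ x<y) 0<y)
      where
      lem : ∀ c y S d e → e + + 2 ≤ d → c + (y - (S + 1ℤ)) ≤ e + 1ℤ → c + (y - S) ≤ d + 1ℤ
      lem c y S d e h₁ h₂ = ≤-trans (i≤i+j _ 1ℤ) (linear (h₁ ⊕ h₂) (solve (c ∷ y ∷ S ∷ d ∷ e ∷ [])))
    idle : σ (S - 1ℤ) ≡ 0ℤ
    idle with Dir-unique (dir fl (S - 1ℤ))
    ... | inj₁ z = z
    ... | inj₂ (inj₁ (r , _)) = ⊥-elim (no-split fl (S - 1ℤ) r (trans (cong σ (k-1+1 S)) e))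
    ... | inj₂ (inj₂ (_ , r)) = ⊥-elim (left-no-fall {a} ls (S - 1ℤ) (≤-reflexive (k-1+1 S)) r)

  module _ {S : ℤ} (ls : LeftSlope a S) (idle : σ S ≡ 0ℤ) where
    private
      left-dir : ∀ k → k ≤ S → σ k ≡ 0ℤ ⊎ (σ k ≡ 1ℤ × + a k + + 2 ≤ + a (k + 1ℤ) × 0 ℕ.< a (k + 1ℤ))
      left-dir k k≤S with <-cmp k S | Dir-unique (dir fl k)
      ... | _ | inj₁ z = inj₁ z
      ... | _ | inj₂ (inj₁ (e , h)) = inj₂ (e , pos-+2≤ h , +2≤⇒0< h)
      ... | tri< lt _ _ | inj₂ (inj₂ (_ , h)) = ⊥-elim (left-no-fall {a} ls k (<⇒+1≤ lt) h)
      ... | tri≈ _ refl _ | inj₂ (inj₂ _) = inj₁ idle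
      ... | tri> _ _ gt | _ = ⊥-elim (<⇒≱ gt k≤S)

      left-nonneg : ∀ k → k ≤ S → 0ℤ ≤ σ k
      left-nonneg k k≤S with left-dir k k≤S
      ... | inj₁ z = ≤-reflexive (sym z)
      ... | inj₂ (e , _) = subst (0ℤ ≤_) (sym e) (+≤+ ℕ.z≤n)

      was-pos : ∀ x → x ≤ S → σ x ≡ 0ℤ → 0 ℕ.< cfg Y x → 0 ℕ.< a x
      was-pos x x≤S z h = ℕₚ.<-≤-trans h (drop‿+≤+ (lem (+ cfg Y x) (+ a x) (σ x) (σ (x - 1ℤ)) (cfg-flow fl x) z
                            (left-nonneg (x - 1ℤ) (≤-trans (<⇒≤ (k-1<k x)) x≤S))))
        where
        lem : ∀ c d s s′ → c ≡ d + s - s′ → s ≡ 0ℤ → 0ℤ ≤ s′ → c ≤ d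
        lem _ d _ s′ refl refl h = linear h (solve (d ∷ s′ ∷ []))

      -- The harmful flows are the grain entering `x` from `x + 1` and the one leaving `y` for
      -- `y - 1`. Each crosses a jump of at least two, so the slope bound taken at `x + 1`, at
      -- `y - 1`, or at both, has the grain to spare.
      core : ∀ x y → x < y → y ≤ S → 0 ℕ.< cfg Y x → + a x + σ x + (y - x) ≤ + a y - σ (y - 1ℤ) + 1ℤ
      core x y x<y y≤S h with left-dir x (≤-trans (<⇒≤ x<y) y≤S) | left-dir (y - 1ℤ) (≤-trans (<⇒≤ (k-1<k y)) y≤S)
      ... | inj₁ e | inj₁ f = lem (+ a x) (+ a y) x y _ _ e f (ls x y x<y y≤S (was-pos x (≤-trans (<⇒≤ x<y) y≤S) e h))
        where
        lem : ∀ c d x y s t → s ≡ 0ℤ → t ≡ 0ℤ → c + (y - x) ≤ d + 1ℤ → c + s + (y - x) ≤ d - t + 1ℤ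
        lem c d x y _ _ refl refl h = linear h (solve (c ∷ d ∷ x ∷ y ∷ []))
      ... | inj₂ (e , u , p) | inj₁ f = lem (+ a x) (+ a y) x y _ _ (+ a (x + 1ℤ)) e f u (left-weak ls (x + 1ℤ) y (<⇒+1≤ x<y) y≤S p)
        where
        lem : ∀ c d x y s t c₁ → s ≡ 1ℤ → t ≡ 0ℤ → c + + 2 ≤ c₁ → c₁ + (y - (x + 1ℤ)) ≤ d + 1ℤ → c + s + (y - x) ≤ d - t + 1ℤ
        lem c d x y _ _ c₁ refl refl h₁ h₂ = linear (h₁ ⊕ h₂) (solve (c ∷ d ∷ x ∷ y ∷ c₁ ∷ []))
      ... | inj₁ e | inj₂ (f , v , _) = lem (+ a x) (+ a y) x y _ _ (+ a (y - 1ℤ)) e f (subst (λ j → + a (y - 1ℤ) + + 2 ≤ + a j) (k-1+1 y) v)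
                (left-weak ls x (y - 1ℤ) (<⇒≤-1 x<y) (≤-trans (<⇒≤ (k-1<k y)) y≤S) (was-pos x (≤-trans (<⇒≤ x<y) y≤S) e h))
        where
        lem : ∀ c d x y s t d₁ → s ≡ 0ℤ → t ≡ 1ℤ → d₁ + + 2 ≤ d → c + (y - 1ℤ - x) ≤ d₁ + 1ℤ → c + s + (y - x) ≤ d - t + 1ℤ
        lem c d x y _ _ d₁ refl refl h₁ h₂ = linear (h₁ ⊕ h₂) (solve (c ∷ d ∷ x ∷ y ∷ d₁ ∷ []))
      ... | inj₂ (e , u , p) | inj₂ (f , v , _) with x + 1ℤ ≤? y - 1ℤ
      ...   | yes g = lem (+ a x) (+ a y) x y _ _ (+ a (x + 1ℤ)) (+ a (y - 1ℤ)) e f u (subst (λ j → + a (y - 1ℤ) + + 2 ≤ + a j) (k-1+1 y) v)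
                (left-weak ls (x + 1ℤ) (y - 1ℤ) g (≤-trans (<⇒≤ (k-1<k y)) y≤S) p)
        where
        lem : ∀ c d x y s t c₁ d₁ → s ≡ 1ℤ → t ≡ 1ℤ → c + + 2 ≤ c₁ → d₁ + + 2 ≤ d → c₁ + (y - 1ℤ - (x + 1ℤ)) ≤ d₁ + 1ℤ → c + s + (y - x) ≤ d - t + 1ℤ
        lem c d x y _ _ c₁ d₁ refl refl h₁ h₂ h₃ = linear (h₁ ⊕ h₂ ⊕ h₃) (solve (c ∷ d ∷ x ∷ y ∷ c₁ ∷ d₁ ∷ []))
      -- Here `x = y - 1`: one grain passes from `y` to `x`, and its own jump of two gives the
      -- bound.
      ...   | no g with ≤-antisym (<⇒≤-1 x<y) (subst (y - 1ℤ ≤_) (k+1-1 x) (<⇒≤-1 (≰⇒> g)))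
      ...     | x≡ = lem (+ a x) (+ a y) x y _ _ e f x≡ (subst (λ j → + a x + + 2 ≤ + a j) (trans (cong (λ j → j + 1ℤ) x≡) (k-1+1 y)) u)
        where
        lem : ∀ c d x y s t → s ≡ 1ℤ → t ≡ 1ℤ → x ≡ y - 1ℤ → c + + 2 ≤ d → c + s + (y - x) ≤ d - t + 1ℤ
        lem c d _ y _ _ refl refl refl h = linear h (solve (c ∷ d ∷ y ∷ []))

    left-flow : LeftSlope (cfg Y) S
    left-flow x y x<y y≤S h = lem (+ cfg Y x) (+ cfg Y y) (+ a x) (+ a y) (σ x) (σ (x - 1ℤ)) (σ y) (σ (y - 1ℤ)) (y - x)
      (cfg-flow fl x) (cfg-flow fl y) (left-nonneg (x - 1ℤ) (≤-trans (<⇒≤ (<-trans (k-1<k x) x<y)) y≤S)) (left-nonneg y y≤S)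
      (core x y x<y y≤S h)
      where
      lem : ∀ c′ d′ c d s₁ s₂ s₃ s₄ e → c′ ≡ c + s₁ - s₂ → d′ ≡ d + s₃ - s₄ → 0ℤ ≤ s₂ → 0ℤ ≤ s₃ →
            c + s₁ + e ≤ d - s₄ + 1ℤ → c′ + e ≤ d′ + 1ℤ
      lem _ _ c d s₁ s₂ s₃ s₄ e refl refl h₁ h₂ h₃ = linear (h₁ ⊕ h₂ ⊕ h₃) (solve (c ∷ d ∷ s₁ ∷ s₂ ∷ s₃ ∷ s₄ ∷ e ∷ []))

  module _ {S : ℤ} (rs : RightSlope a S) (idle : σ S ≡ 0ℤ) where
    private
      right-dir : ∀ k → S ≤ k → σ k ≡ 0ℤ ⊎ (σ k ≡ -1ℤ × + a (k + 1ℤ) + + 2 ≤ + a k × 0 ℕ.< a k)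
      right-dir k S≤k with <-cmp S k | Dir-unique (dir fl k)
      ... | _ | inj₁ z = inj₁ z
      ... | _ | inj₂ (inj₂ (e , h)) = inj₂ (e , pos-+2≤ h , +2≤⇒0< h)
      ... | tri< lt _ _ | inj₂ (inj₁ (_ , h)) = ⊥-elim (right-no-rise {a} rs k lt h)
      ... | tri≈ _ refl _ | inj₂ (inj₁ _) = inj₁ idle
      ... | tri> _ _ gt | _ = ⊥-elim (<⇒≱ gt S≤k)

      right-nonpos : ∀ k → S ≤ k → σ k ≤ 0ℤ
      right-nonpos k S≤k with right-dir k S≤k
      ... | inj₁ z = ≤-reflexive z
      ... | inj₂ (e , _) = subst (_≤ 0ℤ) (sym e) ℤ.-≤+

      was-pos : ∀ y → S ≤ y → σ (y - 1ℤ) ≡ 0ℤ → 0 ℕ.< cfg Y y → 0 ℕ.< a y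
      was-pos y S≤y z h = ℕₚ.<-≤-trans h (drop‿+≤+ (lem (+ cfg Y y) (+ a y) (σ y) (σ (y - 1ℤ)) (cfg-flow fl y) z (right-nonpos y S≤y)))
        where
        lem : ∀ c d s s′ → c ≡ d + s - s′ → s′ ≡ 0ℤ → s ≤ 0ℤ → c ≤ d
        lem _ d s _ refl refl h = linear h (solve (d ∷ s ∷ []))

      -- Mirror image of the left slope: the harmful flows are the grain leaving `x` for `x + 1` and
      -- the one entering `y` from `y - 1`.
      core : ∀ x y → S < x → x < y → 0 ℕ.< cfg Y y → + a y - σ (y - 1ℤ) + (y - x) ≤ + a x + σ x + 1ℤ
      core x y S<x x<y h with right-dir x (<⇒≤ S<x) | right-dir (y - 1ℤ) (≤-trans (<⇒≤ S<x) (<⇒≤-1 x<y))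
      ... | inj₁ e | inj₁ f = lem (+ a x) (+ a y) x y _ _ e f (rs x y S<x x<y (was-pos y (<⇒≤ (<-trans S<x x<y)) f h))
        where
        lem : ∀ c d x y s t → s ≡ 0ℤ → t ≡ 0ℤ → d + (y - x) ≤ c + 1ℤ → d - t + (y - x) ≤ c + s + 1ℤ
        lem c d x y _ _ refl refl h = linear h (solve (c ∷ d ∷ x ∷ y ∷ []))
      ... | inj₂ (e , u , _) | inj₁ f = lem (+ a x) (+ a y) x y _ _ (+ a (x + 1ℤ)) e f u
                (right-weak rs (x + 1ℤ) y (<-trans S<x (k<k+1 x)) (<⇒+1≤ x<y) (was-pos y (<⇒≤ (<-trans S<x x<y)) f h))
        where
        lem : ∀ c d x y s t c₁ → s ≡ -1ℤ → t ≡ 0ℤ → c₁ + + 2 ≤ c → d + (y - (x + 1ℤ)) ≤ c₁ + 1ℤ → d - t + (y - x) ≤ c + s + 1ℤ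
        lem c d x y _ _ c₁ refl refl h₁ h₂ = linear (h₁ ⊕ h₂) (solve (c ∷ d ∷ x ∷ y ∷ c₁ ∷ []))
      ... | inj₁ e | inj₂ (f , v , p) = lem (+ a x) (+ a y) x y _ _ (+ a (y - 1ℤ)) e f (subst (λ j → + a j + + 2 ≤ + a (y - 1ℤ)) (k-1+1 y) v)
                (right-weak rs x (y - 1ℤ) S<x (<⇒≤-1 x<y) p)
        where
        lem : ∀ c d x y s t d₁ → s ≡ 0ℤ → t ≡ -1ℤ → d + + 2 ≤ d₁ → d₁ + (y - 1ℤ - x) ≤ c + 1ℤ → d - t + (y - x) ≤ c + s + 1ℤ
        lem c d x y _ _ d₁ refl refl h₁ h₂ = linear (h₁ ⊕ h₂) (solve (c ∷ d ∷ x ∷ y ∷ d₁ ∷ []))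
      ... | inj₂ (e , u , _) | inj₂ (f , v , p) with x + 1ℤ ≤? y - 1ℤ
      ...   | yes g = lem (+ a x) (+ a y) x y _ _ (+ a (x + 1ℤ)) (+ a (y - 1ℤ)) e f u (subst (λ j → + a j + + 2 ≤ + a (y - 1ℤ)) (k-1+1 y) v)
                (right-weak rs (x + 1ℤ) (y - 1ℤ) (<-trans S<x (k<k+1 x)) g p)
        where
        lem : ∀ c d x y s t c₁ d₁ → s ≡ -1ℤ → t ≡ -1ℤ → c₁ + + 2 ≤ c → d + + 2 ≤ d₁ → d₁ + (y - 1ℤ - (x + 1ℤ)) ≤ c₁ + 1ℤ → d - t + (y - x) ≤ c + s + 1ℤ
        lem c d x y _ _ c₁ d₁ refl refl h₁ h₂ h₃ = linear (h₁ ⊕ h₂ ⊕ h₃) (solve (c ∷ d ∷ x ∷ y ∷ c₁ ∷ d₁ ∷ []))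
      ...   | no g with ≤-antisym (<⇒≤-1 x<y) (subst (y - 1ℤ ≤_) (k+1-1 x) (<⇒≤-1 (≰⇒> g)))
      ...     | x≡ = lem (+ a x) (+ a y) x y _ _ e f x≡ (subst (λ j → + a j + + 2 ≤ + a x) (trans (cong (λ j → j + 1ℤ) x≡) (k-1+1 y)) u)
        where
        lem : ∀ c d x y s t → s ≡ -1ℤ → t ≡ -1ℤ → x ≡ y - 1ℤ → d + + 2 ≤ c → d - t + (y - x) ≤ c + s + 1ℤ
        lem c d _ y _ _ refl refl refl h = linear h (solve (c ∷ d ∷ y ∷ []))

    right-flow : RightSlope (cfg Y) S
    right-flow x y S<x x<y h = lem (+ cfg Y y) (+ cfg Y x) (+ a y) (+ a x) (σ y) (σ (y - 1ℤ)) (σ x) (σ (x - 1ℤ)) (y - x)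
      (cfg-flow fl y) (cfg-flow fl x) (right-nonpos y (<⇒≤ (<-trans S<x x<y))) (right-nonpos (x - 1ℤ) (<⇒≤-1 S<x))
      (core x y S<x x<y h)
      where
      lem : ∀ c′ d′ c d s₁ s₂ s₃ s₄ e → c′ ≡ c + s₁ - s₂ → d′ ≡ d + s₃ - s₄ → s₁ ≤ 0ℤ → s₄ ≤ 0ℤ →
            c - s₂ + e ≤ d + s₃ + 1ℤ → c′ + e ≤ d′ + 1ℤ
      lem _ _ c d s₁ s₂ s₃ s₄ e refl refl h₁ h₂ h₃ = linear (h₁ ⊕ h₂ ⊕ h₃) (solve (c ∷ d ∷ s₁ ∷ s₂ ∷ s₃ ∷ s₄ ∷ e ∷ []))

  slopes-flow : Slopes (cfg X) → Slopes (cfg Y)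
  slopes-flow sl with resplit sl
  ... | S , ls , rs , idle = S , left-flow ls idle , right-flow rs idle

  -- Column `k + 1` would receive from both sides. If it is at most the split, column `k` cannot
  -- fire right on the left slope; otherwise column `k + 2` cannot fire left on the right slope.
  flow-no-valley : Slopes (cfg X) → ∀ k → σ k ≡ -1ℤ → σ (k + 1ℤ) ≡ 1ℤ → ⊥
  flow-no-valley (S , ls , rs) k e f with Dir-unique (dir fl k) | Dir-unique (dir fl (k + 1ℤ)) | k + 1ℤ ≤? S
  ... | inj₁ z | _ | _ = absurd (trans (sym z) e)
    where
    absurd : 0ℤ ≡ -1ℤ → ⊥
    absurd ()
  ... | inj₂ (inj₁ (z , _)) | _ | _ = absurd (trans (sym z) e)
    where
    absurd : 1ℤ ≡ -1ℤ → ⊥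
    absurd ()
  ... | inj₂ (inj₂ (_ , h)) | _ | yes g = left-no-fall {a} ls k g h
  ... | inj₂ (inj₂ _) | inj₁ z | no _ = absurd (trans (sym z) f)
    where
    absurd : 0ℤ ≡ 1ℤ → ⊥
    absurd ()
  ... | inj₂ (inj₂ _) | inj₂ (inj₂ (z , _)) | no _ = absurd (trans (sym z) f)
    where
    absurd : -1ℤ ≡ 1ℤ → ⊥
    absurd ()
  ... | inj₂ (inj₂ _) | inj₂ (inj₁ (_ , h)) | no g = right-no-rise {a} rs (k + 1ℤ) (≰⇒> g) h

  private
    A = pot X

    rises : ∀ k → A k < pot Y k → σ k ≡ 1ℤ
    rises k h with Dir-unique (dir fl k)
    ... | inj₂ (inj₁ (e , _)) = e
    ... | inj₁ z = ⊥-elim (<⇒≱ h (≤-reflexive (trans (pot-flow fl k) (trans (cong (λ t → A k + t) z) (+-identityʳ _)))))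
    ... | inj₂ (inj₂ (z , _)) = ⊥-elim (<⇒≱ h (subst (_≤ A k) (sym (trans (pot-flow fl k) (cong (λ t → A k + t) z))) (<⇒≤ (k-1<k (A k)))))

    falls : ∀ k → pot Y k < A k → σ k ≡ -1ℤ
    falls k h with Dir-unique (dir fl k)
    ... | inj₂ (inj₂ (e , _)) = e
    ... | inj₁ z = ⊥-elim (<⇒≱ h (≤-reflexive (sym (trans (pot-flow fl k) (trans (cong (λ t → A k + t) z) (+-identityʳ _))))))
    ... | inj₂ (inj₁ (z , _)) = ⊥-elim (<⇒≱ h (subst (A k ≤_) (sym (trans (pot-flow fl k) (cong (λ t → A k + t) z))) (i≤i+j (A k) 1ℤ)))

  flow⇒move : Slopes (cfg X) → Move (pot X) (pot Y)
  flow⇒move sl = record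
    { site = λ k → site′ k
    ; peak = λ k h₁ h₂ → no-split fl k (rises k h₁) (falls (k + 1ℤ) h₂)
    ; valley = λ k h₁ h₂ → flow-no-valley sl k (falls k h₁) (rises (k + 1ℤ) h₂)
    }
    where
    site′ : ∀ k → Site (pot X) (pot Y) k
    site′ k with Dir-unique (dir fl k)
    ... | inj₁ z = stay (trans (pot-flow fl k) (trans (cong (λ t → A k + t) z) (+-identityʳ _)))
    ... | inj₂ (inj₁ (e , h)) = up (trans (pot-flow fl k) (cong (λ t → A k + t) e)) (rise⇒pot X k h)
    ... | inj₂ (inj₂ (e , h)) = down (trans (cong (λ t → t + 1ℤ) (trans (pot-flow fl k) (cong (λ t → A k + t) e))) (k-1+1 (A k))) (fall⇒pot X k h)

  ends-flow : ∀ {n w} → Ends n w X → Ends n (suc w) Y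
  ends-flow {n} {w} e = mkEnds
    (λ k h → still k (empty-left e k (<-trans h w<)) (empty-left e (k + 1ℤ) (lt k h)) (pot-left e k (<-trans h w<)))
    (λ k h → still k (empty-right e k (<-≤-trans (+<+ (ℕₚ.n<1+n w)) h)) (empty-right e (k + 1ℤ) (<-≤-trans (+<+ (ℕₚ.n<1+n w)) (≤-trans h (<⇒≤ (k<k+1 k)))))
                   (pot-right e k (≤-trans (+≤+ (ℕₚ.n≤1+n w)) h)))
    where
    w< : - + suc w < - + w
    w< = neg-mono-< (+<+ (ℕₚ.n<1+n w))
    lt : ∀ k → k < - + suc w → k + 1ℤ < - + w
    lt k h = subst (k + 1ℤ <_) (trans (cong (λ z → - z + 1ℤ) (pos-+ 1 w)) (lem (+ w))) (+-monoˡ-< 1ℤ h)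
      where
      lem : ∀ w → - (1ℤ + w) + 1ℤ ≡ - w
      lem w = solve (w ∷ [])
    not2 : ∀ {m} → ¬ (m ℕ.+ 2 ℕ.≤ 0)
    not2 {m} h with +2≤⇒0< {m} h
    ... | ()
    still : ∀ k {p} → a k ≡ 0 → a (k + 1ℤ) ≡ 0 → pot X k ≡ p → pot Y k ≡ p
    still k z₀ z₁ p with Dir-unique (dir fl k)
    ... | inj₁ z = trans (pot-flow fl k) (trans (cong (λ t → A k + t) z) (trans (+-identityʳ _) p))
    ... | inj₂ (inj₁ (_ , h)) = ⊥-elim (not2 (subst (a k ℕ.+ 2 ℕ.≤_) z₁ h))
    ... | inj₂ (inj₂ (_ , h)) = ⊥-elim (not2 (subst (a (k + 1ℤ) ℕ.+ 2 ℕ.≤_) z₀ h))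

-- Parallel steps and their coupling

-- Net flow through a site; the first argument is the choice of the column to its right, the second
-- that of the column to its left.
shift : Choice → Choice → ℤ
shift c c′ = + inFromRight c - + inFromLeft c′

-- A configuration fixes its potential only up to a constant; `pot-update` carries the constant
-- along, so that potentials of different runs stay comparable.
record PMove (X Y : State) : Set where
  field
    choice : ℤ → Choice
    valid  : ∀ i → Valid (cfg X) i (choice i)
    update : ∀ j → cfg Y j ℕ.+ out (choice j) ≡ cfg X j ℕ.+ inFromRight (choice (j + 1ℤ)) ℕ.+ inFromLeft (choice (j - 1ℤ))
    pot-update : ∀ k → pot Y k ≡ pot X k + shift (choice (k + 1ℤ)) (choice k)
open PMove public

PMove⇒PStep : ∀ {X Y} → PMove X Y → PStep (cfg X) (cfg Y)
PMove⇒PStep m = choice m , valid m , update m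

out-split : ∀ c → + out c ≡ + inFromRight c + + inFromLeft c
out-split none = refl
out-split left = refl
out-split right = refl

lift-step : ∀ X {b} → PStep (cfg X) b → ∃ λ Y → cfg Y ≡ b × PMove X Y
lift-step X {b} (d , v , u) = Y , refl , record { choice = d ; valid = v ; update = u ; pot-update = λ _ → refl }
  where
  A′ : ℤ → ℤ
  A′ k = pot X k + shift (d (k + 1ℤ)) (d k)
  lem : ∀ p p₋ a b o r₊ l₋ r l → p ≡ p₋ + a → o ≡ r + l → b + o ≡ a + r₊ + l₋ → p + (r₊ - l) ≡ p₋ + (r - l₋) + b
  lem _ p₋ a b _ r₊ l₋ r l refl refl h = trans (step₁ p₋ a r₊ l₋ l) (trans (cong (λ z → p₋ - l₋ - l + z) (sym h)) (step₂ p₋ b r l l₋))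
    where
    step₁ : ∀ p₋ a r₊ l₋ l → p₋ + a + (r₊ - l) ≡ p₋ - l₋ - l + (a + r₊ + l₋)
    step₁ p₋ a r₊ l₋ l = solve (p₋ ∷ a ∷ r₊ ∷ l₋ ∷ l ∷ [])
    step₂ : ∀ p₋ b r l l₋ → p₋ - l₋ - l + (b + (r + l)) ≡ p₋ + (r - l₋) + b
    step₂ p₋ b r l l₋ = solve (p₋ ∷ b ∷ r ∷ l ∷ l₋ ∷ [])
  Y : State
  Y = record { cfg = b ; pot = A′ ; pot-step = λ k →
    subst (λ j → A′ k ≡ pot X (k - 1ℤ) + shift (d j) (d (k - 1ℤ)) + + b k) (sym (k-1+1 k))
      (lem (pot X k) (pot X (k - 1ℤ)) (+ cfg X k) (+ b k) (+ out (d k)) (+ inFromRight (d (k + 1ℤ))) (+ inFromLeft (d (k - 1ℤ)))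
           (+ inFromRight (d k)) (+ inFromLeft (d k)) (pot-step X k) (out-split (d k)) (cong +_ (u k))) }

left⇒rise : ∀ {a k} → LApp a (k + 1ℤ) → a k ℕ.+ 2 ℕ.≤ a (k + 1ℤ)
left⇒rise {a} {k} h = subst (λ j → a j ℕ.+ 2 ℕ.≤ a (k + 1ℤ)) (k+1-1 k) h

rise⇒left : ∀ {a k} → a k ℕ.+ 2 ℕ.≤ a (k + 1ℤ) → LApp a (k + 1ℤ)
rise⇒left {a} {k} h = subst (λ j → a j ℕ.+ 2 ℕ.≤ a (k + 1ℤ)) (sym (k+1-1 k)) h

+2≤-asym : ∀ {m n} → m ℕ.+ 2 ℕ.≤ n → n ℕ.+ 2 ℕ.≤ m → ⊥
+2≤-asym {m} {n} h₁ h₂ = ℕₚ.<⇒≱ (ℕₚ.<-≤-trans (ℕₚ.m<m+n m (ℕ.s≤s ℕ.z≤n)) h₁) (ℕₚ.≤-trans (ℕₚ.m≤m+n n 2) h₂)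

module _ {X Y : State} (m : PMove X Y) where
  private
    a = cfg X
    d = choice m
    σ : ℤ → ℤ
    σ k = shift (d (k + 1ℤ)) (d k)

  -- Nothing cancels: the jump that lets column `k + 1` fire left forbids column `k` to fire right.
  shift-left : ∀ k → d (k + 1ℤ) ≡ left → σ k ≡ 1ℤ
  shift-left k e = go (d (k + 1ℤ)) (d k) e (valid m (k + 1ℤ)) (valid m k)
    where
    go : ∀ c c′ → c ≡ left → Valid a (k + 1ℤ) c → Valid a k c′ → shift c c′ ≡ 1ℤ
    go _ none refl _ _ = refl
    go _ left refl _ _ = refl
    go _ right refl v v′ = ⊥-elim (+2≤-asym (left⇒rise {a} v) v′)

  shift-right : ∀ k → d k ≡ right → σ k ≡ -1ℤ
  shift-right k e = go (d (k + 1ℤ)) (d k) e (valid m (k + 1ℤ)) (valid m k)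
    where
    go : ∀ c c′ → c′ ≡ right → Valid a (k + 1ℤ) c → Valid a k c′ → shift c c′ ≡ -1ℤ
    go none _ refl _ _ = refl
    go right _ refl _ _ = refl
    go left _ refl v v′ = ⊥-elim (+2≤-asym (left⇒rise {a} v) v′)

  shift≡1 : ∀ k → σ k ≡ 1ℤ → d (k + 1ℤ) ≡ left
  shift≡1 k e = go (d (k + 1ℤ)) (d k) e
    where
    go : ∀ c c′ → shift c c′ ≡ 1ℤ → c ≡ left
    go left _ _ = refl
    go none none ()
    go none left ()
    go none right ()
    go right none ()
    go right left ()
    go right right ()

  shift≡-1 : ∀ k → σ k ≡ -1ℤ → d k ≡ right
  shift≡-1 k e = go (d (k + 1ℤ)) (d k) e
    where
    go : ∀ c c′ → shift c c′ ≡ -1ℤ → c′ ≡ right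
    go _ right _ = refl
    go none none ()
    go none left ()
    go left none ()
    go left left ()
    go right none ()
    go right left ()

  PMove⇒Flow : Flow X Y
  PMove⇒Flow = record
    { s = σ
    ; pot-flow = pot-update m
    ; dir = λ k → go (d (k + 1ℤ)) (d k) (valid m (k + 1ℤ)) (valid m k)
    ; no-split = λ k e f → clash (trans (sym (shift≡1 k e)) (shift≡-1 (k + 1ℤ) f))
    }
    where
    clash : left ≡ right → ⊥
    clash ()
    go : ∀ {k} c c′ → Valid a (k + 1ℤ) c → Valid a k c′ → Dir a k (shift c c′)
    go left none v _ = up (left⇒rise {a} v)
    go left left v _ = up (left⇒rise {a} v)
    go left right v v′ = stay
    go none none _ _ = stay
    go none left _ _ = stay
    go none right _ v′ = down v′
    go right none _ _ = stay
    go right left _ _ = stay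
    go right right _ v′ = down v′

-- `up` and `down` need opposite jumps, so no site can do one in one step and the other in another
-- step from the same configuration.
Dir-bound : ∀ {a k s t} → Dir a k s → Dir a k t → s ≤ t + 1ℤ
Dir-bound (up h) (down g) = ⊥-elim (+2≤-asym h g)
Dir-bound (up h) (up g) = +≤+ (ℕ.s≤s ℕ.z≤n)
Dir-bound (up h) stay = ≤-refl
Dir-bound stay (up g) = +≤+ ℕ.z≤n
Dir-bound stay stay = +≤+ ℕ.z≤n
Dir-bound stay (down g) = ≤-refl
Dir-bound (down h) (up g) = ℤ.-≤+
Dir-bound (down h) stay = ℤ.-≤+
Dir-bound (down h) (down g) = ℤ.-≤+

siblings-close : ∀ {X Y Z} → Flow X Y → Flow X Z → Close (pot Y) (pot Z)
siblings-close {X} {Y} {Z} f g k = bound f g , bound g f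
  where
  lem : ∀ y z x s t → y ≡ x + s → z ≡ x + t → s ≤ t + 1ℤ → y ≤ z + 1ℤ
  lem _ _ x s t refl refl h = linear h (solve (x ∷ s ∷ t ∷ []))
  bound : ∀ {Y Z} → Flow X Y → Flow X Z → pot Y k ≤ pot Z k + 1ℤ
  bound {Y} {Z} f g = lem (pot Y k) (pot Z k) (pot X k) (s f k) (s g k) (pot-flow f k) (pot-flow g k) (Dir-bound (dir f k) (dir g k))

-- Coupling of two parallel steps

choose : ∀ {L R O : Set} → Dec L → Dec R → Dec O → Choice
choose (yes _) (yes _) (yes _) = left
choose (yes _) (yes _) (no _) = right
choose (yes _) (no _) _ = left
choose (no _) (yes _) _ = right
choose (no _) (no _) _ = none

-- Firing left shows that L applies to the one configuration, and this is precisely what makes the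
-- other resolve a tie to the left.
choose-left : ∀ {L R L′ R′ : Set} (l : Dec L) (r : Dec R) (l′ : Dec L′) (r′ : Dec R′) →
              L′ → choose l r l′ ≡ left → choose l′ r′ l ≡ left
choose-left _ _ (no n) _ x _ = ⊥-elim (n x)
choose-left (yes _) _ (yes _) (yes _) _ _ = refl
choose-left (no _) (yes _) (yes _) (yes _) _ ()
choose-left (no _) (no _) (yes _) (yes _) _ ()
choose-left _ _ (yes _) (no _) _ _ = refl

choose-right : ∀ {L R L′ R′ : Set} (l : Dec L) (r : Dec R) (l′ : Dec L′) (r′ : Dec R′) →
               R′ → choose l r l′ ≡ right → choose l′ r′ l ≡ right
choose-right _ _ _ (no n) x _ = ⊥-elim (n x)
choose-right _ _ (no _) (yes _) _ _ = refl
choose-right (no _) _ (yes _) (yes _) _ _ = refl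
choose-right (yes _) (yes _) (yes _) (yes _) _ ()
choose-right (yes _) (no _) (yes _) (yes _) _ ()

LApp? : ∀ a i → Dec (LApp a i)
LApp? a i = a (i - 1ℤ) ℕ.+ 2 ℕ.≤? a i

RApp? : ∀ a i → Dec (RApp a i)
RApp? a i = a (i + 1ℤ) ℕ.+ 2 ℕ.≤? a i

-- Where both rules apply to a, imitating b keeps the potentials close.
follow : Config → Config → ℤ → Choice
follow a b i = choose (LApp? a i) (RApp? a i) (LApp? b i)

follow-valid : ∀ a b i → Valid a i (follow a b i)
follow-valid a b i with LApp? a i | RApp? a i | LApp? b i
... | yes l | yes r | yes _ = l
... | yes l | yes r | no _ = r
... | yes l | no _ | _ = l
... | no _ | yes r | _ = r
... | no l | no r | _ = l , r

out≤ : ∀ {a i} c → Valid a i c → out c ℕ.≤ a i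
out≤ none _ = ℕ.z≤n
out≤ left v = +2≤⇒0< v
out≤ right v = +2≤⇒0< v

fire : ∀ X d → (∀ i → Valid (cfg X) i (d i)) → ∃ λ Y → ∃ λ (m : PMove X Y) → ∀ i → choice m i ≡ d i
fire X d v = proj₁ lifted , proj₂ (proj₂ lifted) , λ _ → refl
  where
  total : ℤ → ℕ
  total j = cfg X j ℕ.+ inFromRight (d (j + 1ℤ)) ℕ.+ inFromLeft (d (j - 1ℤ))
  -- The subtraction never truncates, because a firing column is not empty.
  lifted = lift-step X {λ j → total j ℕ.∸ out (d j)} (d , v , λ j →
    ℕₚ.m∸n+n≡m (ℕₚ.≤-trans (out≤ {cfg X} (d j) (v j)) (ℕₚ.≤-trans (ℕₚ.m≤m+n _ _) (ℕₚ.m≤m+n _ _))))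

module _ (X Y : State) (close : Close (pot X) (pot Y)) (k : ℤ) where
  private
    A = pot X
    B = pot Y

  -- Trouble arises only when `A k = B k + 1` and `A` gains on `B`. The neighbours of `A` then
  -- exceed those of `B` by at most one, so an upward move open to `A` is open to `B`, and a
  -- downward one open to `B` is open to `A`; `push` and `pull` say that it is made.
  keep-close : ∀ {s t} → Dir (cfg X) k s → Dir (cfg Y) k t →
    (s ≡ 1ℤ → cfg Y k ℕ.+ 2 ℕ.≤ cfg Y (k + 1ℤ) → t ≡ 1ℤ) →
    (t ≡ -1ℤ → cfg X (k + 1ℤ) ℕ.+ 2 ℕ.≤ cfg X k → s ≡ -1ℤ) →
    A k + s ≤ B k + t + 1ℤ
  keep-close {s} {t} f g push pull = go f g push pull
    where
    same : ∀ a b s t → a ≤ b + 1ℤ → s ≤ t → a + s ≤ b + t + 1ℤ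
    same a b s t h₁ h₂ = linear (h₁ ⊕ h₂) (solve (a ∷ b ∷ s ∷ t ∷ []))
    tight : ∀ a b s t → a ≤ b → s ≤ t + 1ℤ → a + s ≤ b + t + 1ℤ
    tight a b s t h₁ h₂ = linear (h₁ ⊕ h₂) (solve (a ∷ b ∷ s ∷ t ∷ []))
    steep : ∀ a b a₋ a₊ b₋ b₊ → a₋ ≤ b₋ + 1ℤ → a₊ ≤ b₊ + 1ℤ → b + 1ℤ ≤ a → a + a + + 2 ≤ a₋ + a₊ → b + b + + 2 ≤ b₋ + b₊
    steep a b a₋ a₊ b₋ b₊ h₁ h₂ h₃ h₄ = linear (h₁ ⊕ h₂ ⊕ h₃ ⊕ h₃ ⊕ h₄) (solve (a ∷ b ∷ a₋ ∷ a₊ ∷ b₋ ∷ b₊ ∷ []))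
    steep′ : ∀ a b a₋ a₊ b₋ b₊ → a₋ ≤ b₋ + 1ℤ → a₊ ≤ b₊ + 1ℤ → b + 1ℤ ≤ a → b₋ + b₊ + + 2 ≤ b + b → a₋ + a₊ + + 2 ≤ a + a
    steep′ a b a₋ a₊ b₋ b₊ h₁ h₂ h₃ h₄ = linear (h₁ ⊕ h₂ ⊕ h₃ ⊕ h₃ ⊕ h₄) (solve (a ∷ b ∷ a₋ ∷ a₊ ∷ b₋ ∷ b₊ ∷ []))
    opposite : ∀ a b a₋ a₊ b₋ b₊ → a₋ ≤ b₋ + 1ℤ → a₊ ≤ b₊ + 1ℤ → a + a + + 2 ≤ a₋ + a₊ → b₋ + b₊ + + 2 ≤ b + b → ¬ (b ≤ a)
    opposite a b a₋ a₊ b₋ b₊ h₁ h₂ h₃ h₄ h₅ = refute 1 (h₁ ⊕ h₂ ⊕ h₃ ⊕ h₄ ⊕ h₅ ⊕ h₅) (solve (a ∷ b ∷ a₋ ∷ a₊ ∷ b₋ ∷ b₊ ∷ []))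
    shift-lem : ∀ a b → a + 1ℤ ≤ b → a + 1ℤ ≤ b + -1ℤ + 1ℤ
    shift-lem a b h = linear h (solve (a ∷ b ∷ []))
    go : ∀ {s t} → Dir (cfg X) k s → Dir (cfg Y) k t →
         (s ≡ 1ℤ → cfg Y k ℕ.+ 2 ℕ.≤ cfg Y (k + 1ℤ) → t ≡ 1ℤ) →
         (t ≡ -1ℤ → cfg X (k + 1ℤ) ℕ.+ 2 ℕ.≤ cfg X k → s ≡ -1ℤ) →
         A k + s ≤ B k + t + 1ℤ
    go (up _) (up _) _ _ = same (A k) (B k) _ _ (proj₁ (close k)) ≤-refl
    go stay (up _) _ _ = same (A k) (B k) _ _ (proj₁ (close k)) (+≤+ ℕ.z≤n)
    go stay stay _ _ = same (A k) (B k) _ _ (proj₁ (close k)) ≤-refl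
    go (down _) (up _) _ _ = same (A k) (B k) _ _ (proj₁ (close k)) ℤ.-≤+
    go (down _) stay _ _ = same (A k) (B k) _ _ (proj₁ (close k)) ℤ.-≤+
    go (down _) (down _) _ _ = same (A k) (B k) _ _ (proj₁ (close k)) ≤-refl
    go (up h) stay push _ with A k ≤? B k
    ... | yes A≤B = tight (A k) (B k) _ _ A≤B ≤-refl
    ... | no A≰B with push refl (pot⇒rise Y k (steep (A k) (B k) (A (k - 1ℤ)) (A (k + 1ℤ)) (B (k - 1ℤ)) (B (k + 1ℤ))
                        (proj₁ (close _)) (proj₁ (close _)) (<⇒+1≤ (≰⇒> A≰B)) (rise⇒pot X k h)))
    ...   | ()
    go stay (down h) _ pull with A k ≤? B k
    ... | yes A≤B = tight (A k) (B k) _ _ A≤B ≤-refl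
    ... | no A≰B with pull refl (pot⇒fall X k (steep′ (A k) (B k) (A (k - 1ℤ)) (A (k + 1ℤ)) (B (k - 1ℤ)) (B (k + 1ℤ))
                        (proj₁ (close _)) (proj₁ (close _)) (<⇒+1≤ (≰⇒> A≰B)) (fall⇒pot Y k h)))
    ...   | ()
    -- Opposite moves change the difference by two, but comparing second differences shows that they
    -- require `A k < B k`.
    go (up h) (down g) _ _ = shift-lem (A k) (B k) (<⇒+1≤ (≰⇒> (opposite (A k) (B k) (A (k - 1ℤ)) (A (k + 1ℤ)) (B (k - 1ℤ)) (B (k + 1ℤ))
                        (proj₁ (close _)) (proj₁ (close _)) (rise⇒pot X k h) (fall⇒pot Y k g))))

Close-sym : ∀ {A B} → Close A B → Close B A
Close-sym c k = proj₂ (c k) , proj₁ (c k)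

couple : ∀ X Y → Close (pot X) (pot Y) →
         ∃ λ X′ → ∃ λ Y′ → PMove X X′ × PMove Y Y′ × Close (pot X′) (pot Y′)
couple X Y close with fire X (follow (cfg X) (cfg Y)) (follow-valid _ _) | fire Y (follow (cfg Y) (cfg X)) (follow-valid _ _)
... | X′ , mX , eX | Y′ , mY , eY = X′ , Y′ , mX , mY , λ k → bound X Y X′ Y′ close mX mY eX eY k , bound Y X Y′ X′ (Close-sym close) mY mX eY eX k
  where
  bound : ∀ X Y X′ Y′ → Close (pot X) (pot Y) → (mX : PMove X X′) (mY : PMove Y Y′) →
          (∀ i → choice mX i ≡ follow (cfg X) (cfg Y) i) → (∀ i → choice mY i ≡ follow (cfg Y) (cfg X) i) →
          ∀ k → pot X′ k ≤ pot Y′ k + 1ℤ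
  bound X Y X′ Y′ close mX mY eX eY k = subst₂ (λ p q → p ≤ q + 1ℤ) (sym (pot-update mX k)) (sym (pot-update mY k))
    (keep-close X Y close k (dir (PMove⇒Flow mX) k) (dir (PMove⇒Flow mY) k)
      (λ e h → shift-left mY k (trans (eY (k + 1ℤ))
        (choose-left (LApp? (cfg X) (k + 1ℤ)) (RApp? (cfg X) (k + 1ℤ)) (LApp? (cfg Y) (k + 1ℤ)) (RApp? (cfg Y) (k + 1ℤ))
          (rise⇒left {cfg Y} h) (trans (sym (eX (k + 1ℤ))) (shift≡1 mX k e)))))
      (λ e h → shift-right mX k (trans (eX k)
        (choose-right (LApp? (cfg Y) k) (RApp? (cfg Y) k) (LApp? (cfg X) k) (RApp? (cfg X) k)
          h (trans (sym (eY k)) (shift≡-1 mY k e))))))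

-- Termination

sumAfter : (ℤ → ℤ) → ℤ → ℕ → ℤ
sumAfter f b zero = 0ℤ
sumAfter f b (suc m) = sumAfter f b m + f (b + + suc m)

square : Config → ℤ → ℤ
square a k = + a k * + a k

size : (ℤ → ℤ) → ℤ → ℤ
size s k = + ∣ s k ∣

square≥0 : ∀ a k → 0ℤ ≤ square a k
square≥0 a k = subst (0ℤ ≤_) (pos-* (a k) (a k)) (+≤+ ℕ.z≤n)

sum≥0 : ∀ f b → (∀ k → 0ℤ ≤ f k) → ∀ m → 0ℤ ≤ sumAfter f b m
sum≥0 f b h zero = ≤-refl
sum≥0 f b h (suc m) = +-mono-≤ (sum≥0 f b h m) (h _)

module _ {X Y : State} (fl : Flow X Y) (sl : Slopes (cfg X)) where
  private
    a = cfg X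
    σ = s fl

  -- Amount by which the flow through site `k`, taken alone, lowers the square of column `k + 1`.
  flux : ℤ → ℤ
  flux k = (+ a (k + 1ℤ) + + a (k + 1ℤ)) * σ k - size σ k

  private
    local : ∀ {s t} k j → Dir a k s → Dir a j t → (t ≡ 1ℤ → s ≡ -1ℤ → ⊥) → (t ≡ -1ℤ → s ≡ 1ℤ → ⊥) →
            ∀ c → c ≡ + a k + s - t →
            c * c + (+ ∣ s ∣ + + ∣ s ∣) + ((+ a k + + a k) * t - + ∣ t ∣) ≤ + a k * + a k + ((+ a (k + 1ℤ) + + a (k + 1ℤ)) * s - + ∣ s ∣)
    local k j (up h) (up _) _ _ _ refl = lem (+ a k) (+ a (k + 1ℤ)) (pos-+2≤ h)
      where
      lem : ∀ a c → a + + 2 ≤ c → (a + 1ℤ - 1ℤ) * (a + 1ℤ - 1ℤ) + + 2 + ((a + a) * 1ℤ - 1ℤ) ≤ a * a + ((c + c) * 1ℤ - 1ℤ)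
      lem a c h = ≤-trans (i≤i+j _ (+ 2)) (linear (h ⊕ h) (solve (a ∷ c ∷ [])))
    local k j (up h) stay _ _ _ refl = lem (+ a k) (+ a (k + 1ℤ)) (pos-+2≤ h)
      where
      lem : ∀ a c → a + + 2 ≤ c → (a + 1ℤ - 0ℤ) * (a + 1ℤ - 0ℤ) + + 2 + ((a + a) * 0ℤ - 0ℤ) ≤ a * a + ((c + c) * 1ℤ - 1ℤ)
      lem a c h = linear (h ⊕ h) (solve (a ∷ c ∷ []))
    local k j stay (up _) _ _ _ refl = ≤-reflexive (lem (+ a k) (+ a (k + 1ℤ)))
      where
      lem : ∀ a c → (a + 0ℤ - 1ℤ) * (a + 0ℤ - 1ℤ) + 0ℤ + ((a + a) * 1ℤ - 1ℤ) ≡ a * a + ((c + c) * 0ℤ - 0ℤ)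
      lem a c = solve (a ∷ c ∷ [])
    local k j stay stay _ _ _ refl = ≤-reflexive (lem (+ a k) (+ a (k + 1ℤ)))
      where
      lem : ∀ a c → (a + 0ℤ - 0ℤ) * (a + 0ℤ - 0ℤ) + 0ℤ + ((a + a) * 0ℤ - 0ℤ) ≡ a * a + ((c + c) * 0ℤ - 0ℤ)
      lem a c = solve (a ∷ c ∷ [])
    local k j stay (down _) _ _ _ refl = ≤-reflexive (lem (+ a k) (+ a (k + 1ℤ)))
      where
      lem : ∀ a c → (a + 0ℤ - -1ℤ) * (a + 0ℤ - -1ℤ) + 0ℤ + ((a + a) * -1ℤ - 1ℤ) ≡ a * a + ((c + c) * 0ℤ - 0ℤ)
      lem a c = solve (a ∷ c ∷ [])
    local k j (down h) stay _ _ _ refl = lem (+ a k) (+ a (k + 1ℤ)) (pos-+2≤ h)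
      where
      lem : ∀ a c → c + + 2 ≤ a → (a + -1ℤ - 0ℤ) * (a + -1ℤ - 0ℤ) + + 2 + ((a + a) * 0ℤ - 0ℤ) ≤ a * a + ((c + c) * -1ℤ - 1ℤ)
      lem a c h = linear (h ⊕ h) (solve (a ∷ c ∷ []))
    local k j (down h) (down _) _ _ _ refl = lem (+ a k) (+ a (k + 1ℤ)) (pos-+2≤ h)
      where
      lem : ∀ a c → c + + 2 ≤ a → (a + -1ℤ - -1ℤ) * (a + -1ℤ - -1ℤ) + + 2 + ((a + a) * -1ℤ - 1ℤ) ≤ a * a + ((c + c) * -1ℤ - 1ℤ)
      lem a c h = ≤-trans (i≤i+j _ (+ 2)) (linear (h ⊕ h) (solve (a ∷ c ∷ [])))
    local k j (up _) (down _) _ valley _ _ = ⊥-elim (valley refl refl)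
    local k j (down _) (up _) split _ _ _ = ⊥-elim (split refl refl)

  -- Summed over `k` the flux telescopes: a grain crossing a jump of at least two lowers the sum of
  -- squares by at least two.
  energy-local : ∀ k → square (cfg Y) k + (size σ k + size σ k) + flux (k - 1ℤ) ≤ square a k + flux k
  energy-local k = subst (λ j → square (cfg Y) k + (size σ k + size σ k) + ((+ a j + + a j) * σ (k - 1ℤ) - size σ (k - 1ℤ)) ≤ square a k + flux k) (sym (k-1+1 k))
    (local k (k - 1ℤ) (dir fl k) (dir fl (k - 1ℤ))
      (λ e f → no-split fl (k - 1ℤ) e (trans (cong σ (k-1+1 k)) f))
      (λ e f → flow-no-valley fl sl (k - 1ℤ) e (trans (cong σ (k-1+1 k)) f))
      (+ cfg Y k) (cfg-flow fl k))

  energy-sum : ∀ b m → sumAfter (square (cfg Y)) b m + (sumAfter (size σ) b m + sumAfter (size σ) b m) + flux b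
                       ≤ sumAfter (square a) b m + flux (b + + m)
  energy-sum b zero = ≤-reflexive (trans (lem (flux b)) (cong (λ j → 0ℤ + flux j) (sym (+-identityʳ b))))
    where
    lem : ∀ f → 0ℤ + (0ℤ + 0ℤ) + f ≡ 0ℤ + f
    lem f = solve (f ∷ [])
  energy-sum b (suc m) = lem (sumAfter (square (cfg Y)) b m) (sumAfter (size σ) b m) (flux b) (sumAfter (square a) b m) (flux (b + + m))
      (square (cfg Y) k) (size σ k) (square a k) (flux k) (energy-sum b m)
      (subst (λ j → square (cfg Y) k + (size σ k + size σ k) + flux j ≤ square a k + flux k) (k+suc-1 b m) (energy-local k))
    where
    k = b + + suc m
    lem : ∀ e′ w f e g q v p f′ → e′ + (w + w) + f ≤ e + g → q + (v + v) + g ≤ p + f′ →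
          (e′ + q) + ((w + v) + (w + v)) + f ≤ (e + p) + f′
    lem e′ w f e g q v p f′ h₁ h₂ = linear (h₁ ⊕ h₂) (solve (e′ ∷ w ∷ f ∷ e ∷ g ∷ q ∷ v ∷ p ∷ f′ ∷ []))

  flux≡0 : ∀ k → σ k ≡ 0ℤ → flux k ≡ 0ℤ
  flux≡0 k e = trans (cong (λ t → (+ a (k + 1ℤ) + + a (k + 1ℤ)) * t - + ∣ t ∣) e) (lem (+ a (k + 1ℤ)))
    where
    lem : ∀ c → (c + c) * 0ℤ - 0ℤ ≡ 0ℤ
    lem c = solve (c ∷ [])

  idle-or-active : ∀ b m → (∀ j → b < j → j ≤ b + + m → σ j ≡ 0ℤ) ⊎ 1ℤ ≤ sumAfter (size σ) b m
  idle-or-active b zero = inj₁ λ j b<j j≤b → ⊥-elim (<⇒≱ b<j (subst (j ≤_) (+-identityʳ b) j≤b))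
  idle-or-active b (suc m) with idle-or-active b m | Dir-unique (dir fl (b + + suc m))
  ... | inj₂ h | _ = inj₂ (+-mono-≤ h (+≤+ {n = ∣ σ (b + + suc m) ∣} ℕ.z≤n))
  ... | inj₁ _ | inj₂ (inj₁ (e , _)) = inj₂ (+-mono-≤ (sum≥0 (size σ) b (λ _ → +≤+ ℕ.z≤n) m) (≤-reflexive (cong (λ t → + ∣ t ∣) (sym e))))
  ... | inj₁ _ | inj₂ (inj₂ (e , _)) = inj₂ (+-mono-≤ (sum≥0 (size σ) b (λ _ → +≤+ ℕ.z≤n) m) (≤-reflexive (cong (λ t → + ∣ t ∣) (sym e))))
  ... | inj₁ h | inj₁ z = inj₁ extend
    where
    extend : ∀ j → b < j → j ≤ b + + suc m → σ j ≡ 0ℤ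
    extend j b<j j≤ with <-cmp j (b + + suc m)
    ... | tri< lt _ _ = h j b<j (subst (j ≤_) (k+suc-1 b m) (<⇒≤-1 lt))
    ... | tri≈ _ refl _ = z
    ... | tri> _ _ gt = ⊥-elim (<⇒≱ gt j≤)

  energy-drop : ∀ b m → (∀ k → k ≤ b → σ k ≡ 0ℤ) → (∀ k → b + + m ≤ k → σ k ≡ 0ℤ) →
                (∀ k → σ k ≡ 0ℤ) ⊎ sumAfter (square (cfg Y)) b m + 1ℤ ≤ sumAfter (square a) b m
  energy-drop b m zl zr with idle-or-active b m
  ... | inj₁ z = inj₁ everywhere
    where
    everywhere : ∀ k → σ k ≡ 0ℤ
    everywhere k with k ≤? b | k ≤? b + + m
    ... | yes h | _ = zl k h
    ... | no _ | no h = zr k (<⇒≤ (≰⇒> h))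
    ... | no h | yes g = z k (≰⇒> h) g
  ... | inj₂ h = inj₂ (lem (sumAfter (square (cfg Y)) b m) (sumAfter (size σ) b m) (flux b) (sumAfter (square a) b m) (flux (b + + m))
                   (flux≡0 b (zl b ≤-refl)) (flux≡0 (b + + m) (zr _ ≤-refl)) h (energy-sum b m))
    where
    lem : ∀ e′ w f e g → f ≡ 0ℤ → g ≡ 0ℤ → 1ℤ ≤ w → e′ + (w + w) + f ≤ e + g → e′ + 1ℤ ≤ e
    lem e′ w _ e _ refl refl h₁ h₂ = ≤-trans (i≤i+j _ 1ℤ) (linear (h₁ ⊕ h₁ ⊕ h₂) (solve (e′ ∷ w ∷ e ∷ [])))

-- The number of steps is recorded because coupled runs must have equal length.
data Reach : ℕ → State → State → Set where
  done : ∀ {X} → Reach 0 X X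
  _∷ʳ_ : ∀ {T X Y Z} → PMove X Y → Reach T Y Z → Reach (suc T) X Z
infixr 5 _∷ʳ_

stable-move : ∀ {X Y} → Stable (cfg X) → PMove X Y → cfg X ≈c cfg Y
stable-move {X} {Y} st m j = sym (trans (sym (ℕₚ.+-identityʳ _)) (trans (cong (λ c → cfg Y j ℕ.+ out c) (sym (idle j)))
    (trans (update m j) (trans (cong₂ (λ c c′ → cfg X j ℕ.+ inFromRight c ℕ.+ inFromLeft c′) (idle (j + 1ℤ)) (idle (j - 1ℤ)))
      (trans (ℕₚ.+-identityʳ _) (ℕₚ.+-identityʳ _))))))
  where
  idle : ∀ i → choice m i ≡ none
  idle i with choice m i | valid m i
  ... | none | _ = refl
  ... | left | v = ⊥-elim (proj₁ (st i) v)
  ... | right | v = ⊥-elim (proj₂ (st i) v)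

Stable-≈ : ∀ {a b} → a ≈c b → Stable a → Stable b
Stable-≈ eq st i = (λ h → proj₁ (st i) (subst₂ (λ m n → m ℕ.+ 2 ℕ.≤ n) (sym (eq _)) (sym (eq _)) h))
                 , (λ h → proj₂ (st i) (subst₂ (λ m n → m ℕ.+ 2 ℕ.≤ n) (sym (eq _)) (sym (eq _)) h))

stable-reach : ∀ {T X Y} → Stable (cfg X) → Reach T X Y → Stable (cfg Y)
stable-reach st done = st
stable-reach st (m ∷ʳ r) = stable-reach (Stable-≈ (stable-move st m) st) r

-- A parallel step must fire wherever a rule applies, and firings at a site never cancel.
idle⇒stable : ∀ {X Y} (m : PMove X Y) → (∀ k → s (PMove⇒Flow m) k ≡ 0ℤ) → Stable (cfg X)
idle⇒stable {X} m z i with choice m i in eq | valid m i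
... | none | v = v
... | right | _ = ⊥-elim (absurd (trans (sym (z i)) (shift-right m i eq)))
  where
  absurd : 0ℤ ≡ -1ℤ → ⊥
  absurd ()
... | left | _ = ⊥-elim (absurd (trans (sym (z (i - 1ℤ))) (shift-left m (i - 1ℤ) (trans (cong (choice m) (k-1+1 i)) eq))))
  where
  absurd : 0ℤ ≡ 1ℤ → ⊥
  absurd ()

energy : ℕ → Config → ℤ
energy M a = sumAfter (square a) (- + M) (M ℕ.+ M)

-M+2M : ∀ M → - + M + + (M ℕ.+ M) ≡ + M
-M+2M M = trans (cong (λ z → - + M + z) (pos-+ M M)) (lem (+ M))
  where
  lem : ∀ f → - f + (f + f) ≡ f
  lem f = solve (f ∷ [])

-- A step either is idle, so that `X` is stable already, or lowers the energy by at least one; `T`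
-- exceeds the energy. The width grows by one per step, so `M` bounds the activity throughout the
-- run.
terminates : ∀ T {n w M X Y} → Ends n w X → Slopes (cfg X) → w ℕ.+ T ℕ.< M → energy M (cfg X) + 1ℤ ≤ + T →
             Reach T X Y → Stable (cfg Y)
terminates zero {M = M} {X} _ _ _ h _ = ⊥-elim (lem (energy M (cfg X)) (sum≥0 (square (cfg X)) (- + M) (square≥0 (cfg X)) (M ℕ.+ M)) h)
  where
  lem : ∀ e → 0ℤ ≤ e → e + 1ℤ ≤ 0ℤ → ⊥
  lem e h₁ h₂ = refute 0 (h₁ ⊕ h₂) (solve (e ∷ []))
terminates (suc T) {n} {w} {M} {X} e sl w<M h (_∷ʳ_ {Y = Z} m r) =
    finish (energy-drop fl sl (- + M) (M ℕ.+ M) zl zr)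
  where
  fl = PMove⇒Flow m
  e′ = ends-flow fl e
  sucw+T<M : suc w ℕ.+ T ℕ.< M
  sucw+T<M = subst (ℕ._< M) (ℕₚ.+-suc w T) w<M
  sucw<M : suc w ℕ.< M
  sucw<M = ℕₚ.≤-<-trans (ℕₚ.m≤m+n (suc w) T) sucw+T<M
  cancel : ∀ p q t → q ≡ p + t → p ≡ q → t ≡ 0ℤ
  cancel p _ t h refl = trans (drop p t) (trans (cong (λ z → z - p) (sym h)) (+-inverseʳ p))
    where
    drop : ∀ p t → t ≡ p + t - p
    drop p t = solve (p ∷ t ∷ [])
  zl : ∀ k → k ≤ - + M → s fl k ≡ 0ℤ
  zl k k≤ = cancel (pot X k) (pot Z k) (s fl k) (pot-flow fl k)
    (trans (pot-left e k (≤-<-trans k≤ (neg-mono-< (+<+ (ℕₚ.<-trans (ℕₚ.n<1+n w) sucw<M)))))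
           (sym (pot-left e′ k (≤-<-trans k≤ (neg-mono-< (+<+ sucw<M))))))
  zr : ∀ k → - + M + + (M ℕ.+ M) ≤ k → s fl k ≡ 0ℤ
  zr k k≥ = cancel (pot X k) (pot Z k) (s fl k) (pot-flow fl k)
    (trans (pot-right e k (≤-trans (+≤+ (ℕₚ.<⇒≤ (ℕₚ.<-trans (ℕₚ.n<1+n w) sucw<M))) M≤k))
           (sym (pot-right e′ k (≤-trans (+≤+ (ℕₚ.<⇒≤ sucw<M)) M≤k))))
    where
    M≤k : + M ≤ k
    M≤k = subst (_≤ k) (-M+2M M) k≥
  lem : ∀ e e′ t → e′ + 1ℤ ≤ e → e + 1ℤ ≤ 1ℤ + t → e′ + 1ℤ ≤ t
  lem e e′ t h₁ h₂ = linear (h₁ ⊕ h₂) (solve (e ∷ e′ ∷ t ∷ []))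
  finish : (∀ k → s fl k ≡ 0ℤ) ⊎ energy M (cfg Z) + 1ℤ ≤ energy M (cfg X) → _
  finish (inj₁ z) = stable-reach (idle⇒stable m z) (m ∷ʳ r)
  finish (inj₂ d) = terminates T e′ (slopes-flow fl sl) sucw+T<M (lem (energy M (cfg X)) (energy M (cfg Z)) (+ T) d h) r

-- Runs from a single pile

module _ (n : ℕ) where
  height : ℤ → ℤ
  height (+ _)    = + n
  height -[1+ _ ] = 0ℤ

  start : State
  start = record { cfg = init n ; pot = height ; pot-step = step }
    where
    step : ∀ k → height k ≡ height (k - 1ℤ) + + init n k
    step (+ zero) = refl
    step (+ suc m) = sym (+-identityʳ (+ n))
    step -[1+ m ] = refl

  start-slopes : Slopes (init n)
  start-slopes = 0ℤ , ls , rs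
    where
    ls : LeftSlope (init n) 0ℤ
    ls (+ zero) y x<y y≤0 _ = ⊥-elim (<⇒≱ x<y y≤0)
    ls (+ suc _) y _ _ ()
    ls -[1+ _ ] y _ _ ()
    rs : RightSlope (init n) 0ℤ
    rs x (+ zero) 0<x x<y _ = ⊥-elim (<⇒≱ (<-trans 0<x x<y) ≤-refl)
    rs x (+ suc _) _ _ ()
    rs x -[1+ _ ] _ _ ()

  start-ends : Ends n 0 start
  start-ends = mkEnds l r
    where
    l : ∀ k → k < 0ℤ → height k ≡ 0ℤ
    l (+ m) (+<+ ())
    l -[1+ _ ] _ = refl
    r : ∀ k → 0ℤ ≤ k → height k ≡ + n
    r (+ _) _ = refl
    r -[1+ _ ] ()

  start-energy : ∀ b m → (b + + m < 0ℤ → sumAfter (square (init n)) b m ≤ 0ℤ) × sumAfter (square (init n)) b m ≤ + n * + n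
  start-energy b zero = (λ _ → ≤-refl) , subst (0ℤ ≤_) (pos-* n n) (+≤+ ℕ.z≤n)
  start-energy b (suc m) with b + + suc m in eq | start-energy b m
  ... | + zero | h , _ = (λ { (+<+ ()) })
                       , subst (_≤ + n * + n) refl (≤-trans (+-monoˡ-≤ (+ n * + n) (h (subst (_< 0ℤ) (trans (cong (λ j → j - 1ℤ) (sym eq)) (k+suc-1 b m)) ℤ.-<+)))
                           (≤-reflexive (+-identityˡ (+ n * + n))))
  ... | + suc _ | _ , h = (λ { (+<+ ()) }) , ≤-trans (≤-reflexive (+-identityʳ _)) h
  ... | -[1+ j ] | h₁ , h₂ = (λ _ → ≤-trans (≤-reflexive (+-identityʳ _)) (h₁ b+m<0)) , ≤-trans (≤-reflexive (+-identityʳ _)) h₂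
    where
    b+m<0 : b + + m < 0ℤ
    b+m<0 = subst (_< 0ℤ) (trans (cong (λ j → j - 1ℤ) (sym eq)) (k+suc-1 b m)) ℤ.-<+

  -- The energy at the start is at most the square of `n`, and from width 0 a run of `T` steps stays
  -- inside the window of radius `suc T`.
  settled : ∀ {T Y} → n ℕ.* n ℕ.< T → Reach T start Y → Stable (cfg Y)
  settled {T} n²<T r = terminates T {M = suc T} start-ends start-slopes (ℕₚ.n<1+n T)
    (≤-trans (+-monoˡ-≤ 1ℤ (proj₂ (start-energy (- + suc T) (suc T ℕ.+ suc T)))) (subst (λ z → z + 1ℤ ≤ + T) (pos-* n n) (pos-+1≤ n²<T))) r

-- Lifting the two dynamics to potentials

kick : ℤ → ℤ → ℤ → ℤ
kick p t k with k ≟ p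
... | yes _ = t
... | no _ = 0ℤ

kick-off : ∀ p t k → k ≢ p → kick p t k ≡ 0ℤ
kick-off p t k e with k ≟ p
... | yes h = ⊥-elim (e h)
... | no _ = refl

module _ (X : State) {b : Config} {p t : ℤ} (d : Dir (cfg X) p t)
         (at-p : + b p ≡ + cfg X p + t) (at-p+1 : + b (p + 1ℤ) ≡ + cfg X (p + 1ℤ) - t)
         (rest : ∀ j → j ≢ p → j ≢ p + 1ℤ → b j ≡ cfg X j) where

  single-flow : ∃ λ Y → cfg Y ≡ b × Flow X Y
  single-flow = Y , refl , record { s = kick p t ; pot-flow = λ _ → refl ; dir = dirs ; no-split = nosplit }
    where
    lem : ∀ x x₋ a b s s′ → x ≡ x₋ + a → b ≡ a + s - s′ → x + s ≡ x₋ + s′ + b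
    lem _ x₋ a _ s s′ refl refl = solve (x₋ ∷ a ∷ s ∷ s′ ∷ [])
    col : ∀ k → + b k ≡ + cfg X k + kick p t k - kick p t (k - 1ℤ)
    col k with k ≟ p
    ... | yes refl = trans at-p (trans (sym (+-identityʳ _)) (cong (λ z → + cfg X p + t - z) (sym (kick-off p t (p - 1ℤ) (λ e → <-irrefl e (k-1<k p))))))
    ... | no k≢p with k - 1ℤ ≟ p
    ...   | yes refl = subst (λ j → + b j ≡ + cfg X j + 0ℤ - t) (k-1+1 k) (trans at-p+1 (cong (λ z → z - t) (sym (+-identityʳ (+ cfg X (k - 1ℤ + 1ℤ))))))
    ...   | no k-1≢p = trans (cong +_ (rest k k≢p (λ e → k-1≢p (trans (cong (λ j → j - 1ℤ) e) (k+1-1 p))))) (lem₀ (+ cfg X k))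
      where
      lem₀ : ∀ a → a ≡ a + 0ℤ - 0ℤ
      lem₀ a = solve (a ∷ [])
    Y : State
    Y = record { cfg = b ; pot = λ k → pot X k + kick p t k
               ; pot-step = λ k → lem (pot X k) (pot X (k - 1ℤ)) (+ cfg X k) (+ b k) (kick p t k) (kick p t (k - 1ℤ)) (pot-step X k) (col k) }
    dirs : ∀ k → Dir (cfg X) k (kick p t k)
    dirs k with k ≟ p
    ... | yes refl = d
    ... | no _ = stay
    nosplit : ∀ k → kick p t k ≡ 1ℤ → kick p t (k + 1ℤ) ≡ -1ℤ → ⊥
    nosplit k e f with k ≟ p
    nosplit k () f | no _
    nosplit k e f | yes refl with trans (sym (kick-off p t (p + 1ℤ) (λ e → <-irrefl (sym e) (k<k+1 p)))) f
    ... | ()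

-- A sequential step is a flow through one site, `i - 1` for L and `i` for R, so SSPM inherits every
-- invariant of flows.
lift-sstep : ∀ X {b} → SStep (cfg X) b → ∃ λ Y → cfg Y ≡ b × Flow X Y
lift-sstep X {b} (i , inj₁ (app , dec , inc , rest)) =
  single-flow X {b} {i - 1ℤ} (up (subst (λ j → a (i - 1ℤ) ℕ.+ 2 ℕ.≤ a j) (sym (k-1+1 i)) app))
    (trans (cong +_ inc) (+-comm 1ℤ (+ a (i - 1ℤ))))
    (subst (λ j → + b j ≡ + a j - 1ℤ) (sym (k-1+1 i)) (trans (lem (+ b i)) (cong (λ z → + z - 1ℤ) dec)))
    (λ j h₁ h₂ → rest j (λ e → h₂ (trans e (sym (k-1+1 i)))) h₁)
  where
  a = cfg X
  lem : ∀ b → b ≡ 1ℤ + b - 1ℤ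
  lem b = solve (b ∷ [])
lift-sstep X {b} (i , inj₂ (app , dec , inc , rest)) =
  single-flow X {b} {i} (down app)
    (trans (lem (+ b i)) (cong (λ z → + z - 1ℤ) dec))
    (trans (cong +_ inc) (+-comm 1ℤ (+ a (i + 1ℤ))))
    rest
  where
  a = cfg X
  lem : ∀ b → b ≡ 1ℤ + b - 1ℤ
  lem b = solve (b ∷ [])

-- Chains of close fixed points

stable⇒flat : ∀ {P} → Stable (cfg P) → Flat (pot P)
stable⇒flat {P} st = record
  { flat-up = λ k → lem₁ _ (pot P (k - 1ℤ)) _ (+ cfg P k) (+ cfg P (k + 1ℤ)) (pot-step P k) (pot-next P k) (next≤ {cfg P} st k)
  ; flat-down = λ k → lem₂ _ (pot P (k - 1ℤ)) _ (+ cfg P k) (+ cfg P (k + 1ℤ)) (pot-step P k) (pot-next P k) (prev≤ {cfg P} st k)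
  }
  where
  lem₁ : ∀ p p₋ p₊ c d → p ≡ p₋ + c → p₊ ≡ p + d → d ≤ c + 1ℤ → p₋ + p₊ ≤ p + p + 1ℤ
  lem₁ _ p₋ _ c d refl refl h = linear h (solve (p₋ ∷ c ∷ d ∷ []))
  lem₂ : ∀ p p₋ p₊ c d → p ≡ p₋ + c → p₊ ≡ p + d → c ≤ d + 1ℤ → p + p ≤ p₋ + p₊ + 1ℤ
  lem₂ _ p₋ _ c d refl refl h = linear h (solve (p₋ ∷ c ∷ d ∷ []))

module _ {n w P} (e : Ends n w P) where
  pot≥0 : ∀ k → 0ℤ ≤ pot P k
  pot≥0 k = subst (_≤ pot P k) (pot-left e _ (neg-mono-< (+<+ (far>v w w k)))) (pot-mono P (-far≤k w w k))

  pot≤n : ∀ k → pot P k ≤ + n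
  pot≤n k = subst (pot P k ≤_) (pot-right e _ (+≤+ (ℕₚ.<⇒≤ (far>v w w k)))) (pot-mono P (far≥k w w k))

-- The invariant of a coupled pair: `U` is watched where it is below `P`, `V` where it is above `P`.
record Linked (P U V : State) : Set where
  field
    slopesˡ : Slopes (cfg U)
    slopesʳ : Slopes (cfg V)
    below   : Convex (pot U) (pot P)
    above   : Convex (neg (pot V)) (neg (pot P))
    close   : Close (pot U) (pot V)
    ordered : Ordered (pot P) (pot U) (pot V)
open Linked

module _ {P : State} (stP : Stable (cfg P)) where
  private
    flatP = stable⇒flat {P} stP

  linked-move : ∀ {U V U′ V′} → Slopes (cfg U) → Slopes (cfg V) →
                Convex (pot U) (pot P) → Convex (neg (pot V)) (neg (pot P)) → Ordered (pot P) (pot U) (pot V) →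
                Flow U U′ → Flow V V′ → Close (pot U′) (pot V′) → Linked P U′ V′
  linked-move slU slV bU aV ord f g cl = record
    { slopesˡ = slopes-flow f slU
    ; slopesʳ = slopes-flow g slV
    ; below = b′
    ; above = a′
    ; close = cl
    ; ordered = ordered-move flatP mU mV b′ a′ cl ord
    }
    where
    mU = flow⇒move f slU
    mV = flow⇒move g slV
    b′ = convex-move flatP mU bU
    a′ = convex-move (neg-flat flatP) (neg-move mV) aV

  siblings : ∀ {X Y Z} → Linked P X X → PMove X Y → PMove X Z → Linked P Y Z
  siblings l m m′ = linked-move (slopesˡ l) (slopesʳ l) (below l) (above l) (ordered l)
    (PMove⇒Flow m) (PMove⇒Flow m′) (siblings-close (PMove⇒Flow m) (PMove⇒Flow m′))

  couple-reach : ∀ T {Y Z} → Linked P Y Z → ∃ λ Y′ → ∃ λ Z′ → Reach T Y Y′ × Reach T Z Z′ × Linked P Y′ Z′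
  couple-reach zero {Y} {Z} l = Y , Z , done , done , l
  couple-reach (suc T) {Y} {Z} l with couple Y Z (close l)
  ... | Y₁ , Z₁ , mY , mZ , cl with couple-reach T (linked-move (slopesˡ l) (slopesʳ l) (below l) (above l) (ordered l)
                                                     (PMove⇒Flow mY) (PMove⇒Flow mZ) cl)
  ...   | Y′ , Z′ , rY , rZ , l′ = Y′ , Z′ , mY ∷ʳ rY , mZ ∷ʳ rZ , l′

  Link : ℕ → State → State → State → Set
  Link T X U V = Reach T X U × Reach T X V × Linked P U V

  -- The successors reached by the two first steps are close; running them coupled for `T` steps
  -- ends in a linked pair `Y′`, `Z′`. Induction joins `Y` to `Y′` from the first successor and `Z′`
  -- to `Z` from the second.
  path : ∀ T {X Y Z} → Linked P X X → Reach T X Y → Reach T X Z → Star (Link T X) Y Z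
  path zero l done done = ε
  path (suc T) l (m ∷ʳ r) (m′ ∷ʳ r′) with couple-reach T (siblings l m m′)
  ... | Y′ , Z′ , rY , rZ , l′ =
    Star.map (λ { (p , q , k) → m ∷ʳ p , m ∷ʳ q , k }) (path T (siblings l m m) r rY)
    ◅◅ (m ∷ʳ rY , m′ ∷ʳ rZ , l′) ◅
    Star.map (λ { (p , q , k) → m′ ∷ʳ p , m′ ∷ʳ q , k }) (path T (siblings l m′ m′) rZ r′)

  -- A discrete intermediate value argument along the chain.
  crossing : ∀ {T X U V} (Low High : State → Set) → (∀ Z → Reach T X Z → Low Z ⊎ High Z) →
             Low U → Star (Link T X) U V → Low V ⊎ ∃ λ Z → ∃ λ Z′ → Link T X Z Z′ × Low Z × High Z′
  crossing Low High dec low ε = inj₁ low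
  crossing Low High dec low (_◅_ {j = Z} l p) with dec Z (proj₁ (proj₂ l))
  ... | inj₁ low′ = crossing Low High dec low′ p
  ... | inj₂ high = inj₂ (_ , Z , l , low , high)

  -- The initial potential is 0 before column 0 and `n` from there on, while `pot P` lies between
  -- these values. So the sites below `P` are negative and those above it are not; both sets are
  -- intervals since `pot P` is monotone.
  start-linked : ∀ {n w} → Ends n w P → Linked P (start n) (start n)
  start-linked {n} e = record
    { slopesˡ = start-slopes n
    ; slopesʳ = start-slopes n
    ; below = λ i j k i<j j<k hi hk → bel i j k (<⇒≤ i<j) (<⇒≤ j<k) hi hk
    ; above = λ i j k i<j j<k hi hk → neg-mono-< (abv i j k (<⇒≤ i<j) (<⇒≤ j<k) (neg-cancel-< hi) (neg-cancel-< hk))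
    ; close = λ k → i≤i+j _ 1ℤ , i≤i+j _ 1ℤ
    ; ordered = ord
    }
    where
    H = height n
    bel : ∀ i j k → i ≤ j → j ≤ k → H i < pot P i → H k < pot P k → H j < pot P j
    bel _ _ (+ _) _ _ _ hk = ⊥-elim (<⇒≱ hk (pot≤n e _))
    bel (+ _) _ _ _ _ hi _ = ⊥-elim (<⇒≱ hi (pot≤n e _))
    bel -[1+ _ ] (+ _) -[1+ _ ] _ ()
    bel -[1+ _ ] -[1+ _ ] -[1+ _ ] i≤j _ hi _ = <-≤-trans hi (pot-mono P i≤j)
    abv : ∀ i j k → i ≤ j → j ≤ k → pot P i < H i → pot P k < H k → pot P j < H j
    abv -[1+ _ ] _ _ _ _ hi _ = ⊥-elim (<⇒≱ hi (pot≥0 e _))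
    abv (+ _) _ -[1+ _ ] _ _ _ hk = ⊥-elim (<⇒≱ hk (pot≥0 e _))
    abv (+ _) -[1+ _ ] (+ _) () _ _ _
    abv (+ _) (+ _) (+ _) _ j≤k _ hk = ≤-<-trans (pot-mono P j≤k) hk
    ord : ∀ m q → H m < pot P m → pot P q < H q → m < q
    ord (+ _) _ hm _ = ⊥-elim (<⇒≱ hm (pot≤n e _))
    ord _ -[1+ _ ] _ hq = ⊥-elim (<⇒≱ hq (pot≥0 e _))
    ord -[1+ _ ] (+ _) _ _ = ℤ.-<+

-- Fixed points as ends of runs of a common length

rest-move : ∀ {X} → Stable (cfg X) → PMove X X
rest-move {X} st = record
  { choice = λ _ → none
  ; valid = st
  ; update = λ j → sym (ℕₚ.+-identityʳ _)
  ; pot-update = λ k → sym (+-identityʳ _)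
  }

pad : ∀ {T X Y} → Stable (cfg Y) → Reach T X Y → ∀ m → Reach (T ℕ.+ m) X Y
pad st done zero = done
pad st done (suc m) = rest-move st ∷ʳ pad st done m
pad st (p ∷ʳ r) m = p ∷ʳ pad st r m

Reach⇒Star : ∀ {T X Y} → Reach T X Y → Star PStep (cfg X) (cfg Y)
Reach⇒Star done = ε
Reach⇒Star (m ∷ʳ r) = PMove⇒PStep m ◅ Reach⇒Star r

reach-slopes : ∀ {T X Y} → Slopes (cfg X) → Reach T X Y → Slopes (cfg Y)
reach-slopes sl done = sl
reach-slopes sl (m ∷ʳ r) = reach-slopes (slopes-flow (PMove⇒Flow m) sl) r

reach-ends : ∀ {T n w X Y} → Ends n w X → Reach T X Y → ∃ λ w′ → Ends n w′ Y
reach-ends e done = _ , e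
reach-ends e (m ∷ʳ r) = reach-ends (ends-flow (PMove⇒Flow m) e) r

reach-shape : ∀ {n T Y} → Reach T (start n) Y → Stable (cfg Y) → Shape n Y
reach-shape {n} r st = record
  { stable = st
  ; slopes = reach-slopes (start-slopes n) r
  ; width = proj₁ (reach-ends (start-ends n) r)
  ; ends = proj₂ (reach-ends (start-ends n) r)
  }

lift-psspm : ∀ {a σ} X → cfg X ≡ a → Star PStep a σ → ∃ λ T → ∃ λ Y → cfg Y ≡ σ × Reach T X Y
lift-psspm X e ε = 0 , X , e , done
lift-psspm X refl (p ◅ ps) with lift-step X p
... | Y , e , m with lift-psspm Y e ps
...   | T , Z , e′ , r = suc T , Z , e′ , m ∷ʳ r

lift-sspm : ∀ {a σ n w} X → cfg X ≡ a → Slopes a → Ends n w X → Star SStep a σ →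
            ∃ λ Y → cfg Y ≡ σ × Slopes (cfg Y) × ∃ λ v → Ends n v Y
lift-sspm X refl sl en ε = X , refl , sl , _ , en
lift-sspm X refl sl en (p ◅ ps) with lift-sstep X p
... | Y , refl , f = lift-sspm Y refl (slopes-flow f sl) (ends-flow f en) ps

record Fixed (n : ℕ) (σ : Config) : Set where
  field
    steps   : ℕ
    state   : State
    cfg≡    : cfg state ≡ σ
    reached : Reach steps (start n) state
    shape   : Shape n state
open Fixed

fixed : ∀ {n σ} → FixPSSPM n σ → Fixed n σ
fixed {n} (run , st) with lift-psspm (start n) refl run
... | T , Y , refl , r = record { steps = T ; state = Y ; cfg≡ = refl ; reached = r ; shape = reach-shape r st }

fix-sspm : ∀ {n σ} → FixSSPM n σ → ∃ λ Y → cfg Y ≡ σ × Shape n Y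
fix-sspm {n} (run , st) with lift-sspm (start n) refl (start-slopes n) (start-ends n) run
... | Y , refl , sl , w , en = Y , refl , record { stable = st ; slopes = sl ; width = w ; ends = en }

fixed-path : ∀ {n P σ τ} (sP : Shape n P) (f : Fixed n σ) (g : Fixed n τ) →
             ∃ λ T → n ℕ.* n ℕ.< T × Star (Link {P} (stable sP) T (start n)) (state f) (state g)
fixed-path {n} {P} sP f g = T , n²<T , path {P} (stable sP) T (start-linked {P} (stable sP) (ends sP))
    (pad (stable (shape f)) (reached f) _) (subst (λ t → Reach t (start n) (state g)) swap (pad (stable (shape g)) (reached g) _))
  where
  N = suc (n ℕ.* n)
  -- Either run can be padded to this length, and `N` makes it exceed the square of `n`, so every
  -- member of the chain has settled.
  T = steps f ℕ.+ (steps g ℕ.+ N)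
  n²<T : n ℕ.* n ℕ.< T
  n²<T = ℕₚ.≤-trans (ℕₚ.m≤n+m N (steps g)) (ℕₚ.m≤n+m _ (steps f))
  swap : steps g ℕ.+ (steps f ℕ.+ N) ≡ T
  swap = trans (sym (ℕₚ.+-assoc (steps g) (steps f) N)) (trans (cong (ℕ._+ N) (ℕₚ.+-comm (steps g) (steps f))) (ℕₚ.+-assoc (steps f) (steps g) N))

<lex-asym : ∀ {a b} → a <lex b → b <lex a → ⊥
<lex-asym (i , lt , eq) (j , gt , eq′) with <-cmp i j
... | tri< i<j _ _ = ℕₚ.<-irrefl (sym (eq′ i i<j)) lt
... | tri≈ _ refl _ = ℕₚ.<-asym lt gt
... | tri> _ _ j<i = ℕₚ.<-irrefl (sym (eq j j<i)) gt

≈⇒pot≤ : ∀ {n X Y} → Shape n X → Shape n Y → cfg X ≈c cfg Y → ∀ k → pot X k ≤ pot Y k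
≈⇒pot≤ sX sY eq k = ≤-reflexive (pot≡-below (ends sX) (ends sY) {k + 1ℤ} (λ j _ → eq j) k (k<k+1 k))

ascending : ∀ {k} (f : Fin (suc k) → ℤ → ℤ) → (∀ i m → f (inject₁ i) m ≤ f (fsuc i) m) →
            ∀ i j → toℕ i ℕ.≤ toℕ j → ∀ m → f i m ≤ f j m
ascending f h zero zero _ m = ≤-refl
ascending {suc k} f h zero (fsuc j) _ m = ≤-trans (h zero m) (ascending (λ i → f (fsuc i)) (λ i → h (fsuc i)) zero j ℕ.z≤n m)
ascending {suc k} f h (fsuc i) (fsuc j) (ℕ.s≤s le) m = ascending (λ i → f (fsuc i)) (λ i → h (fsuc i)) i j le m

-- The sorted list of fixed points

module _ (n k : ℕ) (π : Fin (suc k) → Config)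
  (increasing : ∀ i → π (inject₁ i) <lex π (fsuc i))
  (fix : ∀ i → FixPSSPM n (π i))
  (complete : ∀ σ → FixPSSPM n σ → ∃ λ i → π i ≈c σ) where
  private
    F : ∀ i → Fixed n (π i)
    F i = fixed (fix i)
    X : Fin (suc k) → State
    X i = state (F i)
    sX : ∀ i → Shape n (X i)
    sX i = shape (F i)
    X≡π : ∀ i → cfg (X i) ≡ π i
    X≡π i = cfg≡ (F i)
    lex : ∀ i → cfg (X (inject₁ i)) <lex cfg (X (fsuc i))
    lex i = subst₂ _<lex_ (sym (X≡π _)) (sym (X≡π _)) (increasing i)
    asc : ∀ i j → toℕ i ℕ.≤ toℕ j → ∀ m → pot (X i) m ≤ pot (X j) m
    asc = ascending (λ i → pot (X i)) λ i → lex⇒≤ (ends (sX _)) (ends (sX _)) (stable (sX (inject₁ i))) (slopes (sX (fsuc i))) (lex i)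
    index : ∀ {T Z} → Reach T (start n) Z → Stable (cfg Z) → ∃ λ i → π i ≈c cfg Z
    index {Z = Z} r st = complete (cfg Z) (Reach⇒Star r , st)

  -- By completeness every member of the chain is in the list, hence pointwise at most `U` or at
  -- least `V`. Some link `Z`, `Z′` crosses over, and `V` is at most `Z′`, which is at most `Z` plus
  -- 1, hence at most `U` plus 1.
  consecutive : ∀ i → π (inject₁ i) ◁ π (fsuc i)
  -- The chain needs a stable reference configuration; the first fixed point is available for every
  -- `k`.
  consecutive i with fixed-path (sX zero) (F (inject₁ i)) (F (fsuc i))
  ... | T , n²<T , p = subst₂ _◁_ (X≡π _) (X≡π _) (lex∧close⇒◁ (ends (sX _)) (ends (sX _)) (stable (sX (inject₁ i))) (slopes (sX (fsuc i))) (lex i)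
                         (near (crossing {X zero} (stable (sX zero)) Low High dec (λ _ → ≤-refl) p)))
    where
    U = X (inject₁ i)
    V = X (fsuc i)
    Low High : State → Set
    Low Z = ∀ m → pot Z m ≤ pot U m
    High Z = ∀ m → pot V m ≤ pot Z m
    dec : ∀ Z → Reach T (start n) Z → Low Z ⊎ High Z
    dec Z r with index r (settled n n²<T r)
    ... | j , eq with toℕ j ℕ.≤? toℕ i
    ...   | yes j≤i = inj₁ λ m → ≤-trans (≈⇒pot≤ sZ (sX j) (λ c → trans (sym (eq c)) (sym (cong (λ f → f c) (X≡π j)))) m)
                                        (asc j (inject₁ i) (subst (toℕ j ℕ.≤_) (sym (toℕ-inject₁ i)) j≤i) m)
      where
      sZ = reach-shape r (settled n n²<T r)
    ...   | no j≰i = inj₂ λ m → ≤-trans (asc (fsuc i) j (ℕₚ.≰⇒> j≰i) m)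
                                       (≈⇒pot≤ (sX j) sZ (λ c → trans (cong (λ f → f c) (X≡π j)) (eq c)) m)
      where
      sZ = reach-shape r (settled n n²<T r)
    near : Low V ⊎ (∃ λ Z → ∃ λ Z′ → Link {X zero} (stable (sX zero)) T (start n) Z Z′ × Low Z × High Z′) →
           ∀ m → pot V m ≤ pot U m + 1ℤ
    near (inj₁ low) = ⊥-elim (<⇒≱ (+1≤⇒< (lex⇒jump (ends (sX (inject₁ i))) (ends (sX (fsuc i))) (proj₁ (proj₂ (lex i))) (proj₂ (proj₂ (lex i))))) (low _))
    near (inj₂ (Z , Z′ , (_ , _ , l) , low , high)) m = ≤-trans (high m) (≤-trans (proj₂ (close l m)) (+-monoˡ-≤ 1ℤ (low m)))

  -- With `P` as reference, the chain from the first to the last fixed point either meets `P`, which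
  -- then is in the list, or has a link that jumps over `P`.
  between : ∀ σ → FixSSPM n σ → π zero ≤lex σ → σ ≤lex π (fromℕ k) → ∃ λ i → π i ≈c σ
  between σ f (inj₂ eq) _ = zero , eq
  between σ f (inj₁ _) (inj₂ eq) = fromℕ k , λ c → sym (eq c)
  between σ f (inj₁ lo) (inj₁ hi) with fix-sspm f
  ... | P , refl , sP with fixed-path sP (F zero) (F (fromℕ k))
  ...   | T , n²<T , p = found (crossing {P} (stable sP) Low High dec (subst (_<lex cfg P) (sym (X≡π zero)) lo) p)
    where
    Low High : State → Set
    Low Z = cfg Z <lex cfg P
    High Z = cfg Z ≈c cfg P ⊎ cfg P <lex cfg Z
    sZ : ∀ {Z} → Reach T (start n) Z → Shape n Z
    sZ r = reach-shape r (settled n n²<T r)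
    dec : ∀ Z → Reach T (start n) Z → Low Z ⊎ High Z
    dec Z r with lex-compare (ends (sZ r)) (ends sP)
    ... | inj₁ eq = inj₂ (inj₁ eq)
    ... | inj₂ (inj₁ lt) = inj₁ lt
    ... | inj₂ (inj₂ gt) = inj₂ (inj₂ gt)
    found : Low (X (fromℕ k)) ⊎ (∃ λ Z → ∃ λ Z′ → Link {P} (stable sP) T (start n) Z Z′ × Low Z × High Z′) → ∃ λ i → π i ≈c cfg P
    found (inj₁ low) = ⊥-elim (<lex-asym low (subst (cfg P <lex_) (sym (X≡π (fromℕ k))) hi))
    found (inj₂ (Z , Z′ , (_ , r , _) , _ , inj₁ eq)) with index r (settled n n²<T r)
    ... | i , eq′ = i , λ c → trans (eq′ c) (eq c)
    -- A link over `P` is ordered: `Z` is below `P` only at sites before those where `Z′` is above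
    -- it, which three stable configurations do not allow.
    found (inj₂ (Z , Z′ , (r , r′ , l) , low , inj₂ gt)) = ⊥-elim (no-crossing (sZ r) sP (sZ r′) low gt (ordered l))

theorem3 : (n k : ℕ) (π : Fin (suc k) → Config) →
    (∀ i → π (inject₁ i) <lex π (fsuc i)) →
    (∀ i → FixPSSPM n (π i)) →
    (∀ σ → FixPSSPM n σ → ∃ λ i → π i ≈c σ) →
    (∀ i → π (inject₁ i) ◁ π (fsuc i))
    × (∀ σ → FixSSPM n σ → π zero ≤lex σ → σ ≤lex π (fromℕ k) →
         ∃ λ i → π i ≈c σ)
theorem3 n k π increasing fix complete = consecutive n k π increasing fix complete , between n k π increasing fix complete
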